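{- Let $G$ be a finite Abelian group, $H\subset G$ a subgroup such that $G/H$ is cyclic, and $\rho\in G$ an element whose image in $G/H$ is a generator. The image of the monoscopic embedding $\Phi_\rho:\mathcal{C}(H)\to\mathcal{C}(G)$ is a face of $\mathcal{C}(G)$. More precisely, given any face $F\subset\mathcal{C}(H)$ with Kunz poset $P=(H/H',\preceq)$ (where $H'$ is the Kunz subgroup of $F$), the image $\Phi_\rho(F)$ is a face of $\mathcal{C}(G)$ whose Kunz poset is the augmented monoscopic extension of $P$ along $\rho$.
   Context: Group cone: for a finite Abelian group $G$ with $|G|=m$, the group cone $\mathcal{C}(G)\subset\mathbb{R}^{m-1}_{\ge 0}$ (coordinates indexed by $G\setminus\{0\}$) is the pointed cone of all points with non-negative coordinates satisfying $x_i+x_j\ge x_{i+j}$ for all $i,j\in G\setminus\{0\}$ with $i+j\ne 0$. (Non-negativity is implied by the other inequalities when $|G|\ge 3$.) By convention each point of $\mathcal{C}(G)$ is also given a coordinate $x_0=0$ indexed by the identity. Kunz subgroup and Kunz poset: for a face $F\subset\mathcal{C}(G)$, the set $K=\{g\in G: x_g=0\text{ for all }x\in F\}$ is a subgroup of $G$, called the Kunz subgroup of $F$; the Kunz poset of $F$ is the partial order on $G/K$ with unique minimal element $\overline 0$ and $\overline a\preceq\overline b$ whenever $x_a+x_{b-a}=x_b$ for all $x\in F$ ($a,b\in G$ distinct). This is known to be well defined. Monoscopic embedding: let $\beta=|G/H|$. Define $\Phi_\rho:\mathcal{C}(H)\to\mathcal{C}(G)$, $w\mapsto x$, by $x_{a+b\rho}=\beta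 w_a+b\,w_{\beta\rho}$ for each $a\in H$ and each integer $0\le b<\beta$ (here $\beta\rho\in H$, and $w_0=0$). Augmented monoscopic extension: let $P=(H/H',\preceq_P)$ be a poset, with $H'\subset H$ a subgroup. Every element of $G/H'$ is uniquely $a+b\rho$ with $a\in H/H'$, $0\le b\le\beta-1$. The augmented monoscopic extension of $P$ along $\rho$ is: (i) if $\beta\rho\ne 0$ in $H/H'$, the poset $Q=(G/H',\preceq_Q)$ with $a+b\rho\preceq_Q a'+b'\rho$ (for $a,a'\in H/H'$, $0\le b,b'\le\beta-1$) exactly when $a\preceq_P a'$ and either $b\le b'$ or $\beta\rho\preceq_P a'-a$; (ii) if $\beta\rho=0$ in $H/H'$, the poset on $G/(H'+\langle\rho\rangle)$ identical to $P$ under the natural isomorphism $G/(H'+\langle\rho\rangle)\cong H/H'$. -}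

module Defs where

open import Level using (Level; _⊔_; suc)
open import Algebra.Bundles using (AbelianGroup; CommutativeRing; RawGroup)
open import Algebra.Apartness.Bundles using (HeytingField)
import Algebra.Definitions.RawMonoid as RawMonoidDefs
import Algebra.Morphism.GroupMonomorphism as GroupMonomorphism
import Algebra.Properties.AbelianGroup as AbelianGroupProperties
import Algebra.Properties.CommutativeMonoid.Mult as Mult
open import Data.Empty using (⊥-elim)
open import Data.Fin.Base as Fin using (Fin; toℕ; fromℕ<)
import Data.Fin.Properties as Fin
open import Data.Nat.Base as ℕ using (ℕ; zero; NonZero; >-nonZero)
open import Data.Nat.DivMod using (_%_; _/_; m≡m%n+[m/n]*n; m%n<n)
import Data.Nat.Properties as ℕ
open import Data.Product.Base using (Σ; ∃; ∃-syntax; _×_; _,_; proj₁; proj₂)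
open import Data.Sum.Base using (_⊎_; inj₁; inj₂; [_,_]′)
open import Function.Base using (_∘_)
open import Function.Bundles using (Inverse; Injection; _⇔_; Equivalence)
open import Relation.Binary.Bundles using (Setoid)
open import Relation.Binary.Core using (Rel)
open import Relation.Binary.Definitions using (tri<; tri≈; tri>)
open import Relation.Binary.PropositionalEquality as ≡ using (_≡_)
open import Relation.Binary.Structures using (IsEquivalence; IsStrictPartialOrder; IsPartialOrder)
import Relation.Binary.Reasoning.Setoid as SetoidReasoning
open import Relation.Nullary.Negation using (¬_)
open import Relation.Unary using (Pred; _∈_; _∉_; _⊆_; _≐_)

private
  variable
    a b c f f₁ f₂ f₃ k k′ ℓ p q r r′ : Level

------------------------------------------------------------------------
-- Scalars

-- The standard library has no real numbers, so ℝ is replaced by an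
-- arbitrary ordered field.  The axioms are the constructive ones: they
-- hold for the constructive reals, and when _<_ is decidable they are the
-- usual ones, with _#_ being inequality.

record OrderedField f f₁ f₂ f₃ : Set (suc (f ⊔ f₁ ⊔ f₂ ⊔ f₃)) where
  infix 4 _<_ _≤_
  field
    heytingField : HeytingField f f₁ f₂

  open HeytingField heytingField public

  field
    _<_                  : Rel Carrier f₃
    isStrictPartialOrder : IsStrictPartialOrder _≈_ _<_
    #⇔<⊎>                : ∀ x y → x # y ⇔ (x < y ⊎ y < x)
    +-monoˡ-<            : ∀ z {x y} → x < y → x + z < y + z
    *-pos                : ∀ {x y} → 0# < x → 0# < y → 0# < x * y

  _≤_ : Rel Carrier f₃
  x ≤ y = ¬ (y < x)

  commutativeRing : CommutativeRing f f₁
  commutativeRing = record { isCommutativeRing = isCommutativeRing }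

  open CommutativeRing commutativeRing public
    using (+-rawMonoid; +-commutativeMonoid; +-abelianGroup)

  infixr 8 _·_
  _·_ : ℕ → Carrier → Carrier
  _·_ = RawMonoidDefs._×_ +-rawMonoid

------------------------------------------------------------------------
-- Finite abelian groups, subgroups and quotients

HasCardinality : Setoid a b → ℕ → Set (a ⊔ b)
HasCardinality S n = Inverse S (≡.setoid (Fin n))

module Additive (A : AbelianGroup a ℓ) where
  open AbelianGroup A public using () renaming
    ( Carrier to ∣A∣; _≈_ to _≈ᴬ_; _∙_ to _+ᴬ_; ε to 0ᴬ; _⁻¹ to -ᴬ_; _-_ to _-ᴬ_ )

  infixr 8 _·ᴬ_
  _·ᴬ_ : ℕ → ∣A∣ → ∣A∣
  _·ᴬ_ = RawMonoidDefs._×_ (AbelianGroup.rawMonoid A)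

module _ (A : AbelianGroup a ℓ) where
  open Additive A

  -- Congruence modulo K, i.e. equality in A/K.
  CongruentMod : Pred ∣A∣ k → Rel ∣A∣ k
  CongruentMod K x y = x -ᴬ y ∈ K

  record IsSubgroup (H : Pred ∣A∣ p) : Set (a ⊔ ℓ ⊔ p) where
    field
      resp       : ∀ {x y} → x ≈ᴬ y → x ∈ H → y ∈ H
      0-closed   : 0ᴬ ∈ H
      +-closed   : ∀ {x y} → x ∈ H → y ∈ H → x +ᴬ y ∈ H
      neg-closed : ∀ {x} → x ∈ H → -ᴬ x ∈ H

module _ (G : AbelianGroup a ℓ) {H : Pred (AbelianGroup.Carrier G) p}
         (H≤G : IsSubgroup G H) where
  open Additive G
  open IsSubgroup H≤G
  private
    module G = AbelianGroup G
    open AbelianGroupProperties G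

    rawSubgroup : RawGroup (a ⊔ p) ℓ
    rawSubgroup = record
      { Carrier = ∃ H
      ; _≈_     = λ x y → proj₁ x ≈ᴬ proj₁ y
      ; _∙_     = λ (x , x∈H) (y , y∈H) → x +ᴬ y , +-closed x∈H y∈H
      ; ε       = 0ᴬ , 0-closed
      ; _⁻¹     = λ (x , x∈H) → -ᴬ x , neg-closed x∈H
      }

  subgroup : AbelianGroup (a ⊔ p) ℓ
  subgroup = record
    { isAbelianGroup = GroupMonomorphism.isAbelianGroup {G₁ = rawSubgroup} {⟦_⟧ = proj₁}
        (record
          { isGroupHomomorphism = record
            { isMonoidHomomorphism = record
              { isMagmaHomomorphism = record
                { isRelHomomorphism = record { cong = λ eq → eq }
                ; homo              = λ _ _ → G.refl
                }
              ; ε-homo = G.refl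
              }
            ; ⁻¹-homo = λ _ → G.refl
            }
          ; injective = λ eq → eq
          })
        G.isAbelianGroup
    }

  congruentMod-isEquivalence : IsEquivalence (CongruentMod G H)
  congruentMod-isEquivalence = record
    { refl  = resp (G.sym (G.inverseʳ _)) 0-closed
    ; sym   = λ {x} {y} h → resp (⁻¹-anti-homo‿- x y) (neg-closed h)
    ; trans = λ {x} {y} {z} h h′ → resp (telescope x y z) (+-closed h h′)
    }
    where
    open SetoidReasoning G.setoid
    telescope : ∀ x y z → (x -ᴬ y) +ᴬ (y -ᴬ z) ≈ᴬ x -ᴬ z
    telescope x y z = begin
      (x -ᴬ y) +ᴬ (y -ᴬ z)            ≈⟨ G.assoc _ _ _ ⟨
      ((x -ᴬ y) +ᴬ y) -ᴬ z            ≈⟨ G.∙-congʳ (//-rightDividesˡ y x) ⟩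
      x -ᴬ z                          ∎

  quotient : Setoid a p
  quotient = record { isEquivalence = congruentMod-isEquivalence }

------------------------------------------------------------------------
-- A subset K of A together with a relation on representatives of A/K

record QuotientRelation (A : AbelianGroup a ℓ) k r : Set (a ⊔ suc (k ⊔ r)) where
  infix 4 _⪯_
  field
    K   : Pred (AbelianGroup.Carrier A) k
    _⪯_ : Rel (AbelianGroup.Carrier A) r

record IsPosetOnQuotient (A : AbelianGroup a ℓ) (P : QuotientRelation A k r)
                         : Set (a ⊔ ℓ ⊔ k ⊔ r) where
  open QuotientRelation P
  field
    isSubgroup     : IsSubgroup A K
    isPartialOrder : IsPartialOrder (CongruentMod A K) _⪯_
    minimum        : ∀ x → AbelianGroup.ε A ⪯ x

infix 4 _≋_
_≋_ : {A : AbelianGroup a ℓ} → QuotientRelation A k r → QuotientRelation A k′ r′ →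
      Set (a ⊔ k ⊔ r ⊔ k′ ⊔ r′)
P ≋ Q = (P.K ≐ Q.K) × (∀ x y → (x P.⪯ y) ⇔ (x Q.⪯ y))
  where
  module P = QuotientRelation P
  module Q = QuotientRelation Q

------------------------------------------------------------------------
-- Group cone, faces, Kunz posets

module GroupCone (𝔽 : OrderedField f f₁ f₂ f₃) (A : AbelianGroup a ℓ) where
  open OrderedField 𝔽
  open Additive A

  -- The space with coordinates indexed by A ∖ {0}, each point carrying
  -- the additional coordinate x₀ = 0.
  record Point : Set (f ⊔ f₁ ⊔ a ⊔ ℓ) where
    field
      coord      : ∣A∣ → Carrier
      coord-cong : ∀ {i j} → i ≈ᴬ j → coord i ≈ coord j
      coord-0    : coord 0ᴬ ≈ 0#

  open Point public

  infix 4 _≈ᴾ_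
  _≈ᴾ_ : Rel Point (f₁ ⊔ a)
  x ≈ᴾ y = ∀ i → coord x i ≈ coord y i

  infixl 6 _+ᴾ_
  _+ᴾ_ : Point → Point → Point
  x +ᴾ y = record
    { coord      = λ i → coord x i + coord y i
    ; coord-cong = λ i≈j → +-cong (coord-cong x i≈j) (coord-cong y i≈j)
    ; coord-0    = trans (+-cong (coord-0 x) (coord-0 y)) (+-identityˡ 0#)
    }

  infixl 7 _*ᴾ_
  _*ᴾ_ : Carrier → Point → Point
  s *ᴾ x = record
    { coord      = λ i → s * coord x i
    ; coord-cong = λ i≈j → *-cong refl (coord-cong x i≈j)
    ; coord-0    = trans (*-cong refl (coord-0 x)) (zeroʳ s)
    }

  record Cone (x : Point) : Set (a ⊔ ℓ ⊔ f₃) where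
    field
      nonNegative : ∀ i → 0# ≤ coord x i
      subadditive : ∀ i j → ¬ (i ≈ᴬ 0ᴬ) → ¬ (j ≈ᴬ 0ᴬ) → ¬ (i +ᴬ j ≈ᴬ 0ᴬ) →
                    coord x (i +ᴬ j) ≤ coord x i + coord x j

  record IsLinear (φ : Point → Carrier) : Set (f ⊔ f₁ ⊔ a ⊔ ℓ) where
    field
      cong   : ∀ {x y} → x ≈ᴾ y → φ x ≈ φ y
      +-homo : ∀ x y → φ (x +ᴾ y) ≈ φ x + φ y
      *-homo : ∀ s x → φ (s *ᴾ x) ≈ s * φ x

  -- A face of a cone C is C ∩ {φ = 0} for a linear functional φ that is
  -- non-negative on C; φ = 0 gives C itself.
  IsFace : Pred Point p → Set (f ⊔ f₁ ⊔ f₃ ⊔ a ⊔ ℓ ⊔ p)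
  IsFace F = ∃[ φ ] IsLinear φ × (∀ {x} → x ∈ Cone → 0# ≤ φ x)
                  × F ≐ (λ x → x ∈ Cone × φ x ≈ 0#)

  -- When i and j are equal modulo K the condition defining i ⪯ j holds
  -- automatically, so reflexivity needs no separate clause.
  kunz : Pred Point p → QuotientRelation A (f ⊔ f₁ ⊔ a ⊔ ℓ ⊔ p) (f ⊔ f₁ ⊔ a ⊔ ℓ ⊔ p)
  kunz F = record
    { K   = λ i → ∀ x → x ∈ F → coord x i ≈ 0#
    ; _⪯_ = λ i j → ∀ x → x ∈ F → coord x i + coord x (j -ᴬ i) ≈ coord x j
    }

------------------------------------------------------------------------
-- The Kunz poset of a set of points of the cone is a poset on A/K

module OrderedFieldProperties (𝔽 : OrderedField f f₁ f₂ f₃) where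
  open OrderedField 𝔽
  open IsStrictPartialOrder isStrictPartialOrder using (irrefl; <-resp-≈)
    renaming (trans to <-trans)
  open AbelianGroupProperties +-abelianGroup using (//-rightDividesʳ)

  ≤-reflexive : ∀ {x y} → x ≈ y → x ≤ y
  ≤-reflexive x≈y = irrefl (sym x≈y)

  ≤-respˡ : ∀ {x y z} → x ≈ y → x ≤ z → y ≤ z
  ≤-respˡ x≈y x≤z z<y = x≤z (proj₁ <-resp-≈ (sym x≈y) z<y)

  ≤-respʳ : ∀ {x y z} → y ≈ z → x ≤ y → x ≤ z
  ≤-respʳ y≈z x≤y z<x = x≤y (proj₂ <-resp-≈ (sym y≈z) z<x)

  <-asym : ∀ {x y} → x < y → x ≤ y
  <-asym x<y y<x = irrefl refl (<-trans x<y y<x)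

  ≤-trans : ∀ {x y z} → x ≤ y → y ≤ z → x ≤ z
  ≤-trans {x} {y} {z} x≤y y≤z z<x
    with #-cotrans (Equivalence.from (#⇔<⊎> z x) (inj₁ z<x)) y
  ... | inj₁ z#y = [ (λ z<y → y≤z z<y) , (λ y<z → x≤y (<-trans y<z z<x)) ]′
                     (Equivalence.to (#⇔<⊎> z y) z#y)
  ... | inj₂ y#x = [ x≤y , (λ x<y → y≤z (<-trans z<x x<y)) ]′
                     (Equivalence.to (#⇔<⊎> y x) y#x)

  ≤-antisym : ∀ {x y} → x ≤ y → y ≤ x → x ≈ y
  ≤-antisym {x} {y} x≤y y≤x =
    proj₁ (tight x y) ([ y≤x , x≤y ]′ ∘ Equivalence.to (#⇔<⊎> x y))

  +-cancelʳ-≤ : ∀ z {x y} → x + z ≤ y + z → x ≤ y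
  +-cancelʳ-≤ z x+z≤y+z y<x = x+z≤y+z (+-monoˡ-< z y<x)

  +-monoˡ-≤ : ∀ z {x y} → x ≤ y → x + z ≤ y + z
  +-monoˡ-≤ z {x} {y} x≤y =
    +-cancelʳ-≤ (- z) (≤-respˡ (sym (//-rightDividesʳ z x))
                      (≤-respʳ (sym (//-rightDividesʳ z y)) x≤y))

  +-monoʳ-≤ : ∀ z {x y} → x ≤ y → z + x ≤ z + y
  +-monoʳ-≤ z x≤y = ≤-respˡ (+-comm _ z) (≤-respʳ (+-comm _ z) (+-monoˡ-≤ z x≤y))

module _ (𝔽 : OrderedField f f₁ f₂ f₃) (A : AbelianGroup a ℓ) where
  open OrderedField 𝔽
  open OrderedFieldProperties 𝔽
  open GroupCone 𝔽 A
  open Additive A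
  private
    module A = AbelianGroup A
    module AP = AbelianGroupProperties A
    module AM = Mult A.commutativeMonoid

  subadditive′ : ∀ {x} → x ∈ Cone → ∀ i j → coord x (i +ᴬ j) ≤ coord x i + coord x j
  subadditive′ {x} C i j gt = subadditive i j
    (λ i≈0 → irr (≤-respʳ (+-cong (sym (trans (coord-cong x i≈0) (coord-0 x))) refl)
                 (≤-reflexive (trans (coord-cong x (A.trans (A.∙-congʳ i≈0) (A.identityˡ j)))
                                     (sym (+-identityˡ _))))))
    (λ j≈0 → irr (≤-respʳ (+-cong refl (sym (trans (coord-cong x j≈0) (coord-0 x))))
                 (≤-reflexive (trans (coord-cong x (A.trans (A.∙-congˡ j≈0) (A.identityʳ i)))
                                     (sym (+-identityʳ _))))))
    (λ s≈0 → irr (≤-respˡ (sym (trans (coord-cong x s≈0) (coord-0 x)))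
                 (≤-trans (nonNegative i)
                 (≤-respˡ (+-identityʳ _) (+-monoʳ-≤ _ (nonNegative j))))))
    gt
    where
    open Cone C
    irr : ¬ (coord x (i +ᴬ j) ≤ coord x i + coord x j)
    irr le = le gt

  -- An injection into Fin n, rather than a bijection, so that this applies
  -- to subgroups of finite groups as well.
  kunz-isPoset : ∀ {n} → Injection A.setoid (≡.setoid (Fin n)) →
                 {F : Pred Point p} → F ⊆ Cone → IsPosetOnQuotient A (kunz F)
  kunz-isPoset {n = n} enum {F} F⊆C = record
    { isSubgroup = isSubgroup
    ; isPartialOrder = record
      { isPreorder = record
        { isEquivalence = congruentMod-isEquivalence A isSubgroup
        ; reflexive = λ {i} {j} i~j x x∈F →
            trans (+-cong refl (sub (AP.⁻¹-anti-homo‿- i j) (neg i~j) x x∈F))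
                  (trans (+-identityʳ _) (equal i~j x∈F))
        ; trans = λ {i} {j} {k} → ⪯-trans i j k
        }
      ; antisym = antisym
      }
    ; minimum = λ i x x∈F → trans (+-cong (coord-0 x) (coord-cong x
        (A.trans (A.∙-congˡ AP.ε⁻¹≈ε) (A.identityʳ i)))) (+-identityˡ _)
    }
    where
    open QuotientRelation (kunz F)
    open Injection enum using (to; injective)

    nonneg : ∀ {x} → x ∈ F → ∀ i → 0# ≤ coord x i
    nonneg x∈F = Cone.nonNegative (F⊆C x∈F)

    sub : ∀ {i j} → i ≈ᴬ j → i ∈ K → j ∈ K
    sub i≈j i∈K x x∈F = trans (coord-cong x (A.sym i≈j)) (i∈K x x∈F)

    add : ∀ {i j} → i ∈ K → j ∈ K → i +ᴬ j ∈ K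
    add {i} {j} i∈K j∈K x x∈F = ≤-antisym
      (≤-respʳ (trans (+-cong (i∈K x x∈F) (j∈K x x∈F)) (+-identityˡ 0#))
               (subadditive′ (F⊆C x∈F) i j))
      (nonneg x∈F _)

    zer : 0ᴬ ∈ K
    zer x _ = coord-0 x

    mul : ∀ m {i} → i ∈ K → m ·ᴬ i ∈ K
    mul zero    i∈K = zer
    mul (ℕ.suc m) i∈K = add i∈K (mul m i∈K)

    neg : ∀ {i} → i ∈ K → -ᴬ i ∈ K
    neg {i} i∈K with Fin.pigeonhole (ℕ.n<1+n n) (λ m → to (toℕ m ·ᴬ i))
    ... | s , t , s<t , eq = sub (AP.inverseʳ-unique _ _ d≈0) (mul d i∈K)
      where
      d = toℕ t ℕ.∸ ℕ.suc (toℕ s)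
      open SetoidReasoning A.setoid
      d≈0 : i +ᴬ d ·ᴬ i ≈ᴬ 0ᴬ
      d≈0 = AP.identityʳ-unique (toℕ s ·ᴬ i) _ (begin
        toℕ s ·ᴬ i +ᴬ ℕ.suc d ·ᴬ i  ≈⟨ AM.×-homo-+ i (toℕ s) (ℕ.suc d) ⟨
        (toℕ s ℕ.+ ℕ.suc d) ·ᴬ i    ≡⟨ ≡.cong (_·ᴬ i) (≡.trans (ℕ.+-suc (toℕ s) d) (ℕ.m+[n∸m]≡n s<t)) ⟩
        toℕ t ·ᴬ i                  ≈⟨ injective eq ⟨
        toℕ s ·ᴬ i                  ∎)

    isSubgroup : IsSubgroup A K
    isSubgroup = record { resp = sub ; 0-closed = zer ; +-closed = add ; neg-closed = neg }

    half : ∀ {i j} → CongruentMod A K i j → ∀ {x} → x ∈ F → coord x i ≤ coord x j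
    half {i} {j} i~j {x} x∈F =
      ≤-respˡ (coord-cong x (AP.//-rightDividesˡ j i))
      (≤-respʳ (trans (+-cong (i~j _ x∈F) refl) (+-identityˡ _))
      (subadditive′ (F⊆C x∈F) (i -ᴬ j) j))

    equal : ∀ {i j} → CongruentMod A K i j → ∀ {x} → x ∈ F → coord x i ≈ coord x j
    equal {i} {j} i~j x∈F = ≤-antisym (half i~j x∈F)
      (half (sub (AP.⁻¹-anti-homo‿- i j) (neg i~j)) x∈F)

    telescope : ∀ i j k → (k -ᴬ j) +ᴬ (j -ᴬ i) ≈ᴬ k -ᴬ i
    telescope i j k = A.trans (A.sym (A.assoc _ _ _)) (A.∙-congʳ (AP.//-rightDividesˡ j k))

    ⪯-trans : ∀ i j k → i ⪯ j → j ⪯ k → i ⪯ k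
    ⪯-trans i j k i⪯j j⪯k x x∈F = ≤-antisym le
      (≤-respˡ (coord-cong x (A.trans (A.comm _ _) (AP.//-rightDividesˡ i k)))
               (subadditive′ (F⊆C x∈F) i (k -ᴬ i)))
      where
      le : coord x i + coord x (k -ᴬ i) ≤ coord x k
      le = ≤-respʳ (trans (sym (+-assoc _ _ _)) (trans (+-cong (i⪯j x x∈F) refl) (j⪯k x x∈F)))
             (+-monoʳ-≤ _ (≤-respˡ (coord-cong x (telescope i j k))
               (≤-respʳ (+-comm _ _) (subadditive′ (F⊆C x∈F) (k -ᴬ j) (j -ᴬ i)))))

    antisym : ∀ {i j} → i ⪯ j → j ⪯ i → CongruentMod A K i j
    antisym {i} {j} i⪯j j⪯i x x∈F = ≤-antisym
      (≤-respʳ sum≈0 (≤-respˡ (+-identityˡ _) (+-monoˡ-≤ _ (nonneg x∈F (j -ᴬ i)))))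
      (nonneg x∈F _)
      where
      sum≈0 : coord x (j -ᴬ i) + coord x (i -ᴬ j) ≈ 0#
      sum≈0 = AbelianGroupProperties.identityʳ-unique +-abelianGroup (coord x i) _
        (trans (sym (+-assoc _ _ _)) (trans (+-cong (i⪯j x x∈F) refl) (j⪯i x x∈F)))

------------------------------------------------------------------------
-- Monoscopic embeddings and augmented monoscopic extensions

-- The image of ρ generates G/H.  Since G/H is finite, natural multiples
-- suffice.
Generates : (G : AbelianGroup a ℓ) → Pred (AbelianGroup.Carrier G) p →
            AbelianGroup.Carrier G → Set (a ⊔ p)
Generates G H ρ = ∀ g → ∃[ n ] CongruentMod G H g (n ·ᴬ ρ)
  where open Additive G

module CyclicQuotient
  (G : AbelianGroup a ℓ) {H : Pred (AbelianGroup.Carrier G) p} (H≤G : IsSubgroup G H)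
  {β : ℕ} (∣G/H∣≡β : HasCardinality (quotient G H≤G) β)
  {ρ : AbelianGroup.Carrier G} (gen : Generates G H ρ)
  where

  open Additive G
  open IsSubgroup H≤G
  open Inverse ∣G/H∣≡β using (to; from; to-cong; inverseʳ; strictlyInverseˡ)
  private
    module G = AbelianGroup G
    module GP = AbelianGroupProperties G
    module GM = Mult G.commutativeMonoid
    module Q = IsEquivalence (congruentMod-isEquivalence G H≤G)

    _~_ = CongruentMod G H

    ≈⇒~ : ∀ {g h} → g ≈ᴬ h → g ~ h
    ≈⇒~ g≈h = resp (G.sym (GP.x≈y⇒x∙y⁻¹≈ε g≈h)) 0-closed

    ~0 : ∀ {g} → g ~ 0ᴬ → g ∈ H
    ~0 = resp (G.trans (G.∙-congˡ GP.ε⁻¹≈ε) (G.identityʳ _))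

    mul : ∀ m {g} → g ∈ H → m ·ᴬ g ∈ H
    mul zero      g∈H = 0-closed
    mul (ℕ.suc m) g∈H = +-closed g∈H (mul m g∈H)

    -- (m + d)ρ - mρ = dρ
    shift : ∀ m d → (m ℕ.+ d) ·ᴬ ρ -ᴬ m ·ᴬ ρ ≈ᴬ d ·ᴬ ρ
    shift m d = G.trans (G.∙-congʳ (GM.×-homo-+ ρ m d)) (GP.xyx⁻¹≈y (m ·ᴬ ρ) (d ·ᴬ ρ))

    to-injective : ∀ {g h} → to g ≡ to h → g ~ h
    to-injective {g} {h} eq = Q.trans (Q.sym (inverseʳ {g} ≡.refl)) (inverseʳ eq)

    β-nonZero : NonZero β
    β-nonZero = Fin.nonZeroIndex (to 0ᴬ)

    reduce : ∀ d .{{_ : NonZero d}} → d ·ᴬ ρ ∈ H → ∀ n → (n ·ᴬ ρ) ~ ((n % d) ·ᴬ ρ)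
    reduce d dρ∈H n = resp (G.sym eq) (mul (n / d) dρ∈H)
      where
      open SetoidReasoning G.setoid
      eq : n ·ᴬ ρ -ᴬ (n % d) ·ᴬ ρ ≈ᴬ (n / d) ·ᴬ d ·ᴬ ρ
      eq = begin
        n ·ᴬ ρ -ᴬ (n % d) ·ᴬ ρ
          ≡⟨ ≡.cong (λ m → m ·ᴬ ρ -ᴬ (n % d) ·ᴬ ρ) (m≡m%n+[m/n]*n n d) ⟩
        (n % d ℕ.+ n / d ℕ.* d) ·ᴬ ρ -ᴬ (n % d) ·ᴬ ρ
          ≈⟨ shift (n % d) (n / d ℕ.* d) ⟩
        (n / d ℕ.* d) ·ᴬ ρ
          ≈⟨ GM.×-assocˡ ρ (n / d) d ⟨
        (n / d) ·ᴬ d ·ᴬ ρ ∎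

    order-≥ : ∀ d .{{_ : NonZero d}} → d ·ᴬ ρ ∈ H → β ℕ.≤ d
    order-≥ d dρ∈H = Fin.injective⇒≤ {f = residue} residue-injective
      where
      exponent : Fin β → ℕ
      exponent i = proj₁ (gen (from i))

      residue : Fin β → Fin d
      residue i = fromℕ< (m%n<n (exponent i) d)

      from~ : ∀ i → from i ~ ((exponent i % d) ·ᴬ ρ)
      from~ i = Q.trans (proj₂ (gen (from i))) (reduce d dρ∈H (exponent i))

      residue-injective : ∀ {i j} → residue i ≡ residue j → i ≡ j
      residue-injective {i} {j} eq =
        ≡.trans (≡.sym (strictlyInverseˡ i)) (≡.trans (to-cong i~j) (strictlyInverseˡ j))
        where
        same : exponent i % d ≡ exponent j % d
        same = ≡.trans (≡.sym (Fin.toℕ-fromℕ< _)) (≡.trans (≡.cong toℕ eq) (Fin.toℕ-fromℕ< _))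
        i~j : from i ~ from j
        i~j = Q.trans (from~ i) (≡.subst (λ m → (m ·ᴬ ρ) ~ from j) (≡.sym same) (Q.sym (from~ j)))

    difference : ∀ m n → m ℕ.≤ n → (n ·ᴬ ρ) ~ (m ·ᴬ ρ) → (n ℕ.∸ m) ·ᴬ ρ ∈ H
    difference m n m≤n n~m = resp
      (shift m (n ℕ.∸ m))
      (≡.subst (λ e → (e ·ᴬ ρ) ~ (m ·ᴬ ρ)) (≡.sym (ℕ.m+[n∸m]≡n m≤n)) n~m)

  βρ∈H : β ·ᴬ ρ ∈ H
  βρ∈H with Fin.pigeonhole (ℕ.n<1+n β) (λ m → to (toℕ m ·ᴬ ρ))
  ... | s , t , s<t , eq = ≡.subst (λ e → e ·ᴬ ρ ∈ H) d≡β dρ∈H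
    where
    d = toℕ t ℕ.∸ toℕ s
    dρ∈H : d ·ᴬ ρ ∈ H
    dρ∈H = difference (toℕ s) (toℕ t) (ℕ.<⇒≤ s<t) (to-injective (≡.sym eq))
    d≡β : d ≡ β
    d≡β = ℕ.≤-antisym
      (ℕ.≤-trans (ℕ.m∸n≤m (toℕ t) (toℕ s)) (ℕ.≤-pred (Fin.toℕ<n t)))
      (order-≥ d {{>-nonZero (ℕ.m<n⇒0<n∸m s<t)}} dρ∈H)

  -- The unique b with 0 ≤ b < β and g ∈ H + bρ.
  digit : ∣A∣ → ℕ
  digit g = _%_ (proj₁ (gen g)) β {{β-nonZero}}

  digit<β : ∀ g → digit g ℕ.< β
  digit<β g = m%n<n (proj₁ (gen g)) β {{β-nonZero}}

  remainder : ∣A∣ → ∃ H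
  remainder g = g -ᴬ digit g ·ᴬ ρ ,
    Q.trans (proj₂ (gen g)) (reduce β {{β-nonZero}} βρ∈H (proj₁ (gen g)))

  digit-unique : ∀ {b c} → b ℕ.< β → c ℕ.< β → (b ·ᴬ ρ) ~ (c ·ᴬ ρ) → b ≡ c
  digit-unique {b} {c} b<β c<β b~c with ℕ.<-cmp b c
  ... | tri≈ _ b≡c _ = b≡c
  ... | tri< b<c _ _ = ⊥-elim (ℕ.<⇒≱ (ℕ.≤-<-trans (ℕ.m∸n≤m c b) c<β)
          (order-≥ (c ℕ.∸ b) {{>-nonZero (ℕ.m<n⇒0<n∸m b<c)}}
            (difference b c (ℕ.<⇒≤ b<c) (Q.sym b~c))))
  ... | tri> _ _ c<b = ⊥-elim (ℕ.<⇒≱ (ℕ.≤-<-trans (ℕ.m∸n≤m b c) b<β)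
          (order-≥ (b ℕ.∸ c) {{>-nonZero (ℕ.m<n⇒0<n∸m c<b)}}
            (difference c b (ℕ.<⇒≤ c<b) b~c)))

  ~digit : ∀ g → g ~ (digit g ·ᴬ ρ)
  ~digit g = proj₂ (remainder g)

  digit-cong : ∀ {g h} → g ~ h → digit g ≡ digit h
  digit-cong {g} {h} g~h = digit-unique (digit<β g) (digit<β h)
    (Q.trans (Q.sym (~digit g)) (Q.trans g~h (~digit h)))

  digit-+ : ∀ {a b} → a ∈ H → b ℕ.< β → digit (a +ᴬ b ·ᴬ ρ) ≡ b
  digit-+ {a} {b} a∈H b<β = digit-unique (digit<β _) b<β
    (Q.trans (Q.sym (~digit _)) (resp (G.sym (GP.//-rightDividesʳ (b ·ᴬ ρ) a)) a∈H))

  -- The subgroup H as a group, and βρ as an element of it.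
  Hᴳ : AbelianGroup (a ⊔ p) ℓ
  Hᴳ = subgroup G H≤G

  βρ : ∃ H
  βρ = β ·ᴬ ρ , βρ∈H

  open AbelianGroup Hᴳ using () renaming (_-_ to _-ᴴ_)

  module _ (P : QuotientRelation Hᴳ k r) where
    private
      module P = QuotientRelation P

    -- Case βρ ≠ 0 in H/H': a relation on G/H'.
    extend : QuotientRelation G (a ⊔ ℓ ⊔ p ⊔ k) (a ⊔ ℓ ⊔ p ⊔ k ⊔ r)
    extend = record
      { K   = H′
      ; _⪯_ = λ g g′ → Σ (∃ H) λ a → Σ (∃ H) λ a′ → ∃[ b ] ∃[ b′ ]
                (b ℕ.< β) × (b′ ℕ.< β)
              × CongruentMod G H′ g  (proj₁ a  +ᴬ b  ·ᴬ ρ)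
              × CongruentMod G H′ g′ (proj₁ a′ +ᴬ b′ ·ᴬ ρ)
              × (a P.⪯ a′) × ((b ℕ.≤ b′) ⊎ (βρ P.⪯ (a′ -ᴴ a)))
      }
      where
      H′ : Pred (∣A∣) _
      H′ g = Σ (∃ H) λ h → h ∈ P.K × g ≈ᴬ proj₁ h

    -- Case βρ = 0 in H/H': P transported along the isomorphism
    -- H/H' ≅ G/(H' + ⟨ρ⟩) induced by the inclusion of H in G.
    collapse : QuotientRelation G (a ⊔ ℓ ⊔ p ⊔ k) (a ⊔ ℓ ⊔ p ⊔ k ⊔ r)
    collapse = record
      { K   = H′+⟨ρ⟩
      ; _⪯_ = λ g g′ → Σ (∃ H) λ a → Σ (∃ H) λ a′ →
                CongruentMod G H′+⟨ρ⟩ g  (proj₁ a)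
              × CongruentMod G H′+⟨ρ⟩ g′ (proj₁ a′)
              × (a P.⪯ a′)
      }
      where
      H′+⟨ρ⟩ : Pred (∣A∣) _
      H′+⟨ρ⟩ g = Σ (∃ H) λ h → h ∈ P.K × ∃[ n ] g ≈ᴬ proj₁ h +ᴬ n ·ᴬ ρ

    IsAugmentedExtension : QuotientRelation G k′ r′ → Set _
    IsAugmentedExtension Q = (βρ ∉ P.K → Q ≋ extend) × (βρ ∈ P.K → Q ≋ collapse)

  module Embedding (𝔽 : OrderedField f f₁ f₂ f₃) where
    open OrderedField 𝔽
    private
      module Cᴳ = GroupCone 𝔽 G
      module Cᴴ = GroupCone 𝔽 Hᴳ
      module 𝔽M = Mult +-commutativeMonoid

      Φ-coord : Cᴴ.Point → ∣A∣ → Carrier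
      Φ-coord w g = β · Cᴴ.coord w (remainder g) + digit g · Cᴴ.coord w βρ

      Φ-coord-≈ : ∀ w {g a b} → g -ᴬ b ·ᴬ ρ ≈ᴬ proj₁ a → digit g ≡ b →
                  Φ-coord w g ≈ β · Cᴴ.coord w a + b · Cᴴ.coord w βρ
      Φ-coord-≈ w g-bρ≈a ≡.refl = +-cong (𝔽M.×-congʳ β (Cᴴ.coord-cong w g-bρ≈a)) refl

    Φ : Cᴴ.Point → Cᴳ.Point
    Φ w = record
      { coord      = Φ-coord w
      ; coord-cong = λ {g} {h} g≈h →
          Φ-coord-≈ w (G.∙-congʳ g≈h) (digit-cong (≈⇒~ g≈h))
      ; coord-0    = trans
          (Φ-coord-≈ w {a = AbelianGroup.ε Hᴳ} (GP.x≈y⇒x∙y⁻¹≈ε G.refl) digit0)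
          (trans (+-identityʳ _) (trans (𝔽M.×-congʳ β (Cᴴ.coord-0 w)) (zeros β)))
      }
      where
      digit0 : digit 0ᴬ ≡ 0
      digit0 = digit-unique (digit<β 0ᴬ) (ℕ.>-nonZero⁻¹ β {{β-nonZero}}) (Q.sym (~digit 0ᴬ))
      zeros : ∀ m → m · 0# ≈ 0#
      zeros zero      = refl
      zeros (ℕ.suc m) = trans (+-identityˡ _) (zeros m)

    -- This formula determines Φ w, as every element of G is a + bρ with
    -- a ∈ H and b < β.
    Φ-formula : ∀ w (a : ∃ H) {b} → b ℕ.< β →
      Cᴳ.coord (Φ w) (proj₁ a +ᴬ b ·ᴬ ρ) ≈ β · Cᴴ.coord w a + b · Cᴴ.coord w βρ
    Φ-formula w a {b} b<β =
      Φ-coord-≈ w (GP.//-rightDividesʳ (b ·ᴬ ρ) (proj₁ a)) (digit-+ (proj₂ a) b<β)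

    Image : Pred Cᴴ.Point q → Pred Cᴳ.Point _
    Image F x = ∃[ w ] w ∈ F × Φ w Cᴳ.≈ᴾ x

{-# OPTIONS --safe #-}

-- The image of the cone of H is cut out of the cone of G by turning the valid inequalities
-- x_{a+bρ} ≤ x_a + b x_ρ and x_{βρ} ≤ β x_ρ into equalities; on it w is recovered as
-- x|_H / β, so restriction to H pulls a face F back to its image.  For x = Φ w, the
-- difference of a + bρ and a′ + b′ρ is again of this form, with a carry of βρ exactly when
-- b′ < b, and comparing coefficients turns x_g + x_{g′-g} = x_g′ into conditions on w.

module Submission where

open import Defs
open import Level using (Level)
open import Algebra.Bundles using (AbelianGroup; CommutativeMonoid; CommutativeRing)
import Algebra.Apartness.Properties.HeytingCommutativeRing as HeytingProperties
import Algebra.Properties.AbelianGroup as AbelianGroupProperties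
import Algebra.Properties.CommutativeMonoid.Mult as Mult
import Algebra.Properties.CommutativeSemigroup as CommutativeSemigroupProperties
import Algebra.Properties.Ring as RingProperties
import Algebra.Properties.Semiring.Mult as SemiringMult
open import Data.Empty using (⊥-elim)
open import Data.Fin.Base as Fin using (Fin)
open import Data.Nat.Base as ℕ using (ℕ; zero; suc; NonZero)
import Data.Nat.Properties as ℕ
open import Data.Product.Base using (∃; ∃-syntax; _×_; _,_; proj₁; proj₂)
open import Data.Sum.Base using (_⊎_; inj₁; inj₂; [_,_]′)
open import Function.Base using (_∘_)
open import Function.Bundles using (Inverse; mk⇔; Equivalence)
open import Function.Properties.Inverse using (Inverse⇒Injection)
open import Relation.Binary.PropositionalEquality as ≡ using (_≡_)
open import Relation.Binary.Structures using (IsStrictPartialOrder; IsPartialOrder)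
import Relation.Binary.Reasoning.Setoid as SetoidReasoning
open import Relation.Unary using (Pred; _∈_; _∉_; _⊆_; _≐_; _∩_)

private
  variable
    a c f f₁ f₂ f₃ ℓ p p′ q : Level

-- Regrouping natural multiples in a commutative monoid.

module MultiplesProperties (M : CommutativeMonoid c ℓ) where
  open CommutativeMonoid M
  open Mult M using (×-homo-+) renaming (_×_ to _·_)
  open CommutativeSemigroupProperties commutativeSemigroup using (interchange)

  -- Needed in two monoids at once: in `G` with `v` equal to `ρ`, and in the scalars with `v` the
  -- coordinate of `w` at `βρ`. The same holds for `+-×-carry`.
  +-×-interchange : ∀ x y v m n → (x ∙ m · v) ∙ (y ∙ n · v) ≈ (x ∙ y) ∙ (m ℕ.+ n) · v
  +-×-interchange x y v m n =
    trans (interchange x (m · v) y (n · v)) (∙-congˡ (sym (×-homo-+ v m n)))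

  +-×-carry : ∀ x v m n → x ∙ (m ℕ.+ n) · v ≈ (x ∙ m · v) ∙ n · v
  +-×-carry x v m n = trans (∙-congˡ (×-homo-+ v m n)) (sym (assoc x (m · v) (n · v)))

-- Order, natural multiples and division by positive integers in an ordered field.

module OrderedFieldMultiples (𝔽 : OrderedField f f₁ f₂ f₃) where
  open OrderedField 𝔽
  open OrderedFieldProperties 𝔽
  open IsStrictPartialOrder isStrictPartialOrder using (<-resp-≈)
    renaming (trans to <-trans)
  open CommutativeRing commutativeRing using (ring; semiring)
  open RingProperties ring using (-‿distribˡ-*; -‿involutive)
  open HeytingProperties heytingCommutativeRing using (1#0; x-0≈x)
  open SemiringMult semiring using (×-comm-*; ×-assoc-*)
  open Mult +-commutativeMonoid using (×-congʳ)

  +-mono-≤ : ∀ {x y u v} → x ≤ y → u ≤ v → x + u ≤ y + v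
  +-mono-≤ x≤y u≤v = ≤-trans (+-monoˡ-≤ _ x≤y) (+-monoʳ-≤ _ u≤v)

  -- From `y + v ≈ x + u ≤ x + v`, cancelling `v` gives the missing inequality `y ≤ x`.
  +-tightˡ : ∀ {x y u v} → x ≤ y → u ≤ v → x + u ≈ y + v → x ≈ y
  +-tightˡ {v = v} x≤y u≤v eq = ≤-antisym x≤y
    (+-cancelʳ-≤ v (≤-respˡ eq (+-monoʳ-≤ _ u≤v)))

  +-nonNeg : ∀ {x y} → 0# ≤ x → 0# ≤ y → 0# ≤ x + y
  +-nonNeg 0≤x 0≤y = ≤-respˡ (+-identityˡ 0#) (+-mono-≤ 0≤x 0≤y)

  +-conicalˡ : ∀ {x y} → 0# ≤ x → 0# ≤ y → x + y ≈ 0# → x ≈ 0#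
  +-conicalˡ 0≤x 0≤y eq = sym (+-tightˡ 0≤x 0≤y (trans (+-identityˡ 0#) (sym eq)))

  +-conicalʳ : ∀ {x y} → 0# ≤ x → 0# ≤ y → x + y ≈ 0# → y ≈ 0#
  +-conicalʳ 0≤x 0≤y eq = +-conicalˡ 0≤y 0≤x (trans (+-comm _ _) eq)

  ·-zeroʳ : ∀ n → n · 0# ≈ 0#
  ·-zeroʳ zero    = refl
  ·-zeroʳ (suc n) = trans (+-identityˡ _) (·-zeroʳ n)

  ·-mono-≤ : ∀ n {x y} → x ≤ y → n · x ≤ n · y
  ·-mono-≤ zero    x≤y = ≤-reflexive refl
  ·-mono-≤ (suc n) x≤y = +-mono-≤ x≤y (·-mono-≤ n x≤y)

  ·-nonNeg : ∀ n {x} → 0# ≤ x → 0# ≤ n · x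
  ·-nonNeg n 0≤x = ≤-respˡ (·-zeroʳ n) (·-mono-≤ n 0≤x)

  +-monoʳ-< : ∀ z {x y} → x < y → z + x < z + y
  +-monoʳ-< z x<y =
    proj₁ <-resp-≈ (+-comm _ z) (proj₂ <-resp-≈ (+-comm _ z) (+-monoˡ-< z x<y))

  ·-mono-< : ∀ n .{{_ : NonZero n}} {x y} → x < y → n · x < n · y
  ·-mono-< (suc zero)      x<y = +-monoˡ-< 0# x<y
  ·-mono-< (suc n@(suc _)) x<y =
    <-trans (+-monoˡ-< _ x<y) (+-monoʳ-< _ (·-mono-< n x<y))

  -- As `≤` is the negation of the reversed `<`, this is the contrapositive of strict monotonicity.
  ·-cancel-≤ : ∀ n .{{_ : NonZero n}} {x y} → n · x ≤ n · y → x ≤ y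
  ·-cancel-≤ n nx≤ny y<x = nx≤ny (·-mono-< n y<x)

  ·-cancel-≈ : ∀ n .{{_ : NonZero n}} {x y} → n · x ≈ n · y → x ≈ y
  ·-cancel-≈ n eq = ≤-antisym (·-cancel-≤ n (≤-reflexive eq))
                              (·-cancel-≤ n (≤-reflexive (sym eq)))

  ·-≈0 : ∀ n .{{_ : NonZero n}} {x} → n · x ≈ 0# → x ≈ 0#
  ·-≈0 n eq = ·-cancel-≈ n (trans eq (sym (·-zeroʳ n)))

  -- Rewrites a natural multiple as a scalar multiple, to which `*-homo` of a linear functional
  -- applies.
  ·≈·1* : ∀ n x → n · x ≈ (n · 1#) * x
  ·≈·1* n x = trans (×-congʳ n (sym (*-identityˡ x))) (sym (×-assoc-* n 1# x))

  -- Apartness of 1 and 0 leaves two cases; if `1# < 0#`, then `- 1#` is positive, and so is its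
  -- square, which is 1.
  0<1 : 0# < 1#
  0<1 with Equivalence.to (#⇔<⊎> 1# 0#) 1#0
  ... | inj₂ 0<1 = 0<1
  ... | inj₁ 1<0 = proj₁ <-resp-≈ [-1][-1]≈1 (*-pos 0<-1 0<-1)
    where
    0<-1 : 0# < - 1#
    0<-1 = proj₁ <-resp-≈ (+-identityˡ _) (proj₂ <-resp-≈ (-‿inverseʳ 1#) (+-monoˡ-< (- 1#) 1<0))
    [-1][-1]≈1 : - 1# * - 1# ≈ 1#
    [-1][-1]≈1 = trans (sym (-‿distribˡ-* 1# (- 1#)))
                       (trans (-‿cong (*-identityˡ _)) (-‿involutive 1#))

  -- `n · 1#` is positive, hence apart from 0, hence invertible. The factor `r` does not depend on
  -- `x`, so a whole point can be divided by `n` with `*ᴾ`.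
  ·-divisible : ∀ n .{{_ : NonZero n}} → ∃[ r ] ∀ x → n · (r * x) ≈ x
  ·-divisible n = r , λ x → begin
    n · (r * x)       ≈⟨ ×-comm-* n r x ⟨
    r * (n · x)       ≈⟨ *-congˡ (·≈·1* n x) ⟩
    r * (n · 1# * x)  ≈⟨ *-assoc r (n · 1#) x ⟨
    r * n · 1# * x    ≈⟨ *-congʳ r*n≈1 ⟩
    1# * x            ≈⟨ *-identityˡ x ⟩
    x                 ∎
    where
    open SetoidReasoning setoid
    0<n : 0# < n · 1#
    0<n = proj₂ <-resp-≈ (·-zeroʳ n) (·-mono-< n 0<1)
    -- What gets inverted is the difference `n · 1# - 0#`; `r*n≈1` below drops the subtracted zero.
    inverse = #⇒invertible (Equivalence.from (#⇔<⊎> (n · 1#) 0#) (inj₂ 0<n))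
    r = proj₁ inverse
    r*n≈1 : r * n · 1# ≈ 1#
    r*n≈1 = trans (*-congˡ (sym (x-0≈x _))) (proj₁ (proj₂ inverse))

-- Linear functionals and faces of a group cone.

module FaceProperties (𝔽 : OrderedField f f₁ f₂ f₃) (A : AbelianGroup a ℓ) where
  open OrderedField 𝔽
  open OrderedFieldProperties 𝔽
  open OrderedFieldMultiples 𝔽
  open GroupCone 𝔽 A
  open Additive A
  open CommutativeRing commutativeRing using (ring; semiring)
  open RingProperties ring using (-‿distribʳ-*)
  open SemiringMult semiring using (×-comm-*)
  open Mult +-commutativeMonoid using (×-congʳ; ×-distrib-+)
  open CommutativeSemigroupProperties
    (CommutativeMonoid.commutativeSemigroup +-commutativeMonoid) using (interchange)
  open AbelianGroupProperties +-abelianGroup using (⁻¹-∙-comm; x∙y⁻¹≈ε⇒x≈y; x≈y⇒x∙y⁻¹≈ε)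
  private
    module IsLin = IsLinear

  zero-linear : IsLinear (λ _ → 0#)
  zero-linear = record
    { cong   = λ _ → refl
    ; +-homo = λ _ _ → sym (+-identityˡ 0#)
    ; *-homo = λ s _ → sym (zeroʳ s)
    }

  coord-linear : ∀ i → IsLinear (λ x → coord x i)
  coord-linear i = record
    { cong   = λ x≈y → x≈y i
    ; +-homo = λ _ _ → refl
    ; *-homo = λ _ _ → refl
    }

  +-linear : ∀ {φ ψ} → IsLinear φ → IsLinear ψ → IsLinear (λ x → φ x + ψ x)
  +-linear φ-lin ψ-lin = record
    { cong   = λ x≈y → +-cong (IsLin.cong φ-lin x≈y) (IsLin.cong ψ-lin x≈y)
    ; +-homo = λ x y → trans (+-cong (IsLin.+-homo φ-lin x y) (IsLin.+-homo ψ-lin x y))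
                             (interchange _ _ _ _)
    ; *-homo = λ s x → trans (+-cong (IsLin.*-homo φ-lin s x) (IsLin.*-homo ψ-lin s x))
                             (sym (distribˡ s _ _))
    }

  neg-linear : ∀ {φ} → IsLinear φ → IsLinear (λ x → - φ x)
  neg-linear φ-lin = record
    { cong   = λ x≈y → -‿cong (IsLin.cong φ-lin x≈y)
    ; +-homo = λ x y → trans (-‿cong (IsLin.+-homo φ-lin x y)) (sym (⁻¹-∙-comm _ _))
    ; *-homo = λ s x → trans (-‿cong (IsLin.*-homo φ-lin s x)) (-‿distribʳ-* s _)
    }

  ·-linear : ∀ n {φ} → IsLinear φ → IsLinear (λ x → n · φ x)
  ·-linear n φ-lin = record
    { cong   = λ x≈y → ×-congʳ n (IsLin.cong φ-lin x≈y)
    ; +-homo = λ x y → trans (×-congʳ n (IsLin.+-homo φ-lin x y)) (×-distrib-+ _ _ n)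
    ; *-homo = λ s x → trans (×-congʳ n (IsLin.*-homo φ-lin s x)) (sym (×-comm-* n s _))
    }

  Cone-isFace : IsFace Cone
  Cone-isFace = (λ _ → 0#) , zero-linear , (λ _ → ≤-reflexive refl) , (λ x∈C → x∈C , refl) , proj₁

  -- The supporting functional is the slack `ψ - φ` of the valid inequality.
  equality-isFace : ∀ {φ ψ} → IsLinear φ → IsLinear ψ → (∀ {x} → x ∈ Cone → φ x ≤ ψ x) →
                    IsFace (λ x → x ∈ Cone × φ x ≈ ψ x)
  equality-isFace {φ} {ψ} φ-lin ψ-lin φ≤ψ =
    (λ x → ψ x - φ x) , +-linear ψ-lin (neg-linear φ-lin) ,
    (λ x∈C → ≤-respˡ (-‿inverseʳ _) (+-monoˡ-≤ _ (φ≤ψ x∈C))) ,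
    (λ (x∈C , eq) → x∈C , x≈y⇒x∙y⁻¹≈ε (sym eq)) ,
    (λ (x∈C , eq) → x∈C , sym (x∙y⁻¹≈ε⇒x≈y _ _ eq))

  face-⊆ : {F : Pred Point p} → IsFace F → F ⊆ Cone
  face-⊆ (_ , _ , _ , F⊆ , _) x∈F = proj₁ (F⊆ x∈F)

  face-resp-≐ : {F : Pred Point p} {F′ : Pred Point p′} → F ≐ F′ → IsFace F → IsFace F′
  face-resp-≐ (F⊆F′ , F′⊆F) (φ , φ-lin , φ≥0 , F⊆ , ⊆F) =
    φ , φ-lin , φ≥0 , F⊆ ∘ F′⊆F , F⊆F′ ∘ ⊆F

  -- The sum of the two functionals works: both are non-negative on the cone, so the sum vanishes
  -- only where each of them does.
  face-∩ : {F : Pred Point p} {F′ : Pred Point p′} → IsFace F → IsFace F′ → IsFace (F ∩ F′)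
  face-∩ (φ , φ-lin , φ≥0 , F⊆ , ⊆F) (ψ , ψ-lin , ψ≥0 , F′⊆ , ⊆F′) =
    (λ x → φ x + ψ x) , +-linear φ-lin ψ-lin ,
    (λ x∈C → +-nonNeg (φ≥0 x∈C) (ψ≥0 x∈C)) ,
    (λ (x∈F , x∈F′) → proj₁ (F⊆ x∈F) ,
      trans (+-cong (proj₂ (F⊆ x∈F)) (proj₂ (F′⊆ x∈F′))) (+-identityˡ 0#)) ,
    (λ (x∈C , eq) → ⊆F  (x∈C , +-conicalˡ (φ≥0 x∈C) (ψ≥0 x∈C) eq) ,
                    ⊆F′ (x∈C , +-conicalʳ (φ≥0 x∈C) (ψ≥0 x∈C) eq))

  -- The conjunct `x ∈ Cone` matters for the empty family, whose intersection must be the cone and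
  -- not the whole space.
  face-⋂ : ∀ {n} {F : Fin n → Pred Point p} → (∀ i → IsFace (F i)) →
           IsFace (λ x → x ∈ Cone × (∀ i → x ∈ F i))
  face-⋂ {n = zero}  F-face = face-resp-≐ ((λ x∈C → x∈C , λ ()) , proj₁) Cone-isFace
  face-⋂ {n = suc n} F-face = face-resp-≐
    ( (λ (x∈F₀ , x∈C , x∈F) → x∈C , λ { Fin.zero → x∈F₀ ; (Fin.suc i) → x∈F i })
    , (λ (x∈C , x∈F) → x∈F Fin.zero , x∈C , x∈F ∘ Fin.suc) )
    (face-∩ (F-face Fin.zero) (face-⋂ (F-face ∘ Fin.suc)))

  Cone-resp-≈ : ∀ {x y} → x ≈ᴾ y → x ∈ Cone → y ∈ Cone
  Cone-resp-≈ x≈y x∈C = record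
    { nonNegative = λ i → ≤-respʳ (x≈y i) (Cone.nonNegative x∈C i)
    ; subadditive = λ i j i≉0 j≉0 i+j≉0 → ≤-respˡ (x≈y _) (≤-respʳ (+-cong (x≈y i) (x≈y j))
                      (Cone.subadditive x∈C i j i≉0 j≉0 i+j≉0))
    }

  -- Each cone inequality for `y` is `n` times the one for `x`, and `n · φ x ≈ φ y ≈ 0#`, so `n`
  -- cancels throughout. This puts the point recovered by dividing by β back into the face.
  face-·⁻ : ∀ n .{{_ : NonZero n}} {F : Pred Point p} → IsFace F → ∀ {x y} →
            (∀ i → n · coord x i ≈ coord y i) → y ∈ F → x ∈ F
  face-·⁻ n (φ , φ-lin , _ , F⊆ , ⊆F) {x} {y} nx≈y y∈F = ⊆F (x∈C , φx≈0)
    where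
    y∈C = proj₁ (F⊆ y∈F)
    x∈C : x ∈ Cone
    x∈C = record
      { nonNegative = λ i → ·-cancel-≤ n (≤-respˡ (sym (·-zeroʳ n))
          (≤-respʳ (sym (nx≈y i)) (Cone.nonNegative y∈C i)))
      ; subadditive = λ i j i≉0 j≉0 i+j≉0 → ·-cancel-≤ n (≤-respˡ (sym (nx≈y _))
          (≤-respʳ (trans (+-cong (sym (nx≈y i)) (sym (nx≈y j))) (sym (×-distrib-+ _ _ n)))
          (Cone.subadditive y∈C i j i≉0 j≉0 i+j≉0)))
      }
    φx≈0 : φ x ≈ 0#
    φx≈0 = ·-≈0 n (trans (·≈·1* n _) (trans (sym (IsLin.*-homo φ-lin _ x))
      (trans (IsLin.cong φ-lin (λ i → trans (sym (·≈·1* n _)) (nx≈y i))) (proj₂ (F⊆ y∈F)))))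

  face-·⁺ : ∀ n {F : Pred Point p} → IsFace F → ∀ {x y} →
            (∀ i → n · coord x i ≈ coord y i) → y ∈ Cone → x ∈ F → y ∈ F
  face-·⁺ n (φ , φ-lin , _ , F⊆ , ⊆F) {x} {y} nx≈y y∈C x∈F = ⊆F (y∈C , (begin
    φ y                  ≈⟨ IsLin.cong φ-lin (λ i → trans (sym (nx≈y i)) (·≈·1* n _)) ⟩
    φ (n · 1# *ᴾ x)      ≈⟨ IsLin.*-homo φ-lin (n · 1#) x ⟩
    n · 1# * φ x         ≈⟨ *-congˡ (proj₂ (F⊆ x∈F)) ⟩
    n · 1# * 0#          ≈⟨ zeroʳ _ ⟩
    0#                   ∎))
    where open SetoidReasoning setoid

  coord-·-≤ : ∀ {x} → x ∈ Cone → ∀ n i → coord x (n ·ᴬ i) ≤ n · coord x i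
  coord-·-≤ {x} x∈C zero    i = ≤-reflexive (coord-0 x)
  coord-·-≤ {x} x∈C (suc n) i =
    ≤-trans (subadditive′ 𝔽 A x∈C i (n ·ᴬ i)) (+-monoʳ-≤ _ (coord-·-≤ x∈C n i))

module Monoscopic
  (𝔽 : OrderedField f f₁ f₂ f₃)
  (G : AbelianGroup a ℓ) {m : ℕ} (∣G∣≡m : HasCardinality (AbelianGroup.setoid G) m)
  {H : Pred (AbelianGroup.Carrier G) p} (H≤G : IsSubgroup G H)
  {β : ℕ} (∣G/H∣≡β : HasCardinality (quotient G H≤G) β)
  {ρ : AbelianGroup.Carrier G} (gen : Generates G H ρ)
  where

  open CyclicQuotient G H≤G ∣G/H∣≡β gen
  open Embedding 𝔽
  open OrderedField 𝔽
  open OrderedFieldProperties 𝔽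
  open OrderedFieldMultiples 𝔽
  open Additive G
  open IsSubgroup H≤G
  open Mult +-commutativeMonoid using (×-congʳ; ×-distrib-+)
  open MultiplesProperties +-commutativeMonoid using (+-×-interchange; +-×-carry)
  open AbelianGroup Hᴳ using () renaming (_∙_ to _+ᴴ_; _-_ to _-ᴴ_; ε to 0ᴴ)
  private
    module Cᴳ = GroupCone 𝔽 G
    module Cᴴ = GroupCone 𝔽 Hᴳ
    module Fᴳ = FaceProperties 𝔽 G
    module Fᴴ = FaceProperties 𝔽 Hᴳ
    module G = AbelianGroup G
    module GP = AbelianGroupProperties G
    module GM = MultiplesProperties G.commutativeMonoid
    module K = AbelianGroupProperties +-abelianGroup

    instance
      β-nonZero : NonZero β
      β-nonZero = ℕ.>-nonZero (ℕ.≤-<-trans ℕ.z≤n (digit<β 0ᴬ))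

  -- Coordinates of `Φ w`, their sums, and the image of the cone.

  decompose : ∀ g → g ≈ᴬ proj₁ (remainder g) +ᴬ digit g ·ᴬ ρ
  decompose g = G.sym (GP.//-rightDividesˡ (digit g ·ᴬ ρ) g)

  Φ-≈ : ∀ w (c : ∃ H) {b g} → b ℕ.< β → g ≈ᴬ proj₁ c +ᴬ b ·ᴬ ρ →
        Cᴳ.coord (Φ w) g ≈ β · Cᴴ.coord w c + b · Cᴴ.coord w βρ
  Φ-≈ w c b<β g≈ = trans (Cᴳ.coord-cong (Φ w) g≈) (Φ-formula w c b<β)

  -- Elements of `H` have digit 0. So restricting `Φ w` to `H` multiplies `w` by β, and dividing by
  -- β recovers `w`.
  Φ-H : ∀ w (c : ∃ H) → Cᴳ.coord (Φ w) (proj₁ c) ≈ β · Cᴴ.coord w c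
  Φ-H w c = trans (Φ-≈ w c (ℕ.>-nonZero⁻¹ β) (G.sym (G.identityʳ _))) (+-identityʳ _)

  -- For `b = β` the defining formula does not apply, as β is not a digit; there `βρ` lies in `H`
  -- and `Φ-H` gives the value.
  Φ-multiple : ∀ w {b} → b ℕ.≤ β → Cᴳ.coord (Φ w) (b ·ᴬ ρ) ≈ b · Cᴴ.coord w βρ
  Φ-multiple w {b} b≤β = [ below , top ]′ (ℕ.<-≤-connex b β)
    where
    below : b ℕ.< β → Cᴳ.coord (Φ w) (b ·ᴬ ρ) ≈ b · Cᴴ.coord w βρ
    below b<β = trans (Φ-≈ w 0ᴴ b<β (G.sym (G.identityˡ (b ·ᴬ ρ))))
      (trans (+-congʳ (trans (×-congʳ β (Cᴴ.coord-0 w)) (·-zeroʳ β))) (+-identityˡ _))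
    top : β ℕ.≤ b → Cᴳ.coord (Φ w) (b ·ᴬ ρ) ≈ b · Cᴴ.coord w βρ
    top β≤b = ≡.subst (λ n → Cᴳ.coord (Φ w) (n ·ᴬ ρ) ≈ n · Cᴴ.coord w βρ)
      (ℕ.≤-antisym β≤b b≤β) (Φ-H w βρ)

  -- The case `b = 1` of `Φ-multiple`. The bound `1 ≤ β` suffices, so β = 1, where `ρ` itself lies
  -- in `H`, is included.
  Φ-ρ : ∀ w → Cᴳ.coord (Φ w) ρ ≈ Cᴴ.coord w βρ
  Φ-ρ w = trans (Cᴳ.coord-cong (Φ w) (G.sym (G.identityʳ ρ)))
                (trans (Φ-multiple w (ℕ.>-nonZero⁻¹ β)) (+-identityʳ _))

  Φ-nonNeg : ∀ {w} → w ∈ Cᴴ.Cone → ∀ g → 0# ≤ Cᴳ.coord (Φ w) g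
  Φ-nonNeg w∈C g = +-nonNeg (·-nonNeg β (Cᴴ.Cone.nonNegative w∈C _))
                            (·-nonNeg (digit g) (Cᴴ.Cone.nonNegative w∈C βρ))

  sum-≈ : ∀ {g h a a′} b b′ → g ≈ᴬ a +ᴬ b ·ᴬ ρ → h ≈ᴬ a′ +ᴬ b′ ·ᴬ ρ →
          g +ᴬ h ≈ᴬ (a +ᴬ a′) +ᴬ (b ℕ.+ b′) ·ᴬ ρ
  sum-≈ {a = a} {a′} b b′ g≈ h≈ =
    G.trans (G.∙-cong g≈ h≈) (GM.+-×-interchange a a′ ρ b b′)

  sum-carry-≈ : ∀ {g h a a′} b b′ {n} → b ℕ.+ b′ ≡ β ℕ.+ n →
                g ≈ᴬ a +ᴬ b ·ᴬ ρ → h ≈ᴬ a′ +ᴬ b′ ·ᴬ ρ →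
                g +ᴬ h ≈ᴬ ((a +ᴬ a′) +ᴬ β ·ᴬ ρ) +ᴬ n ·ᴬ ρ
  sum-carry-≈ {a = a} {a′} b b′ {n} eq g≈ h≈ = G.trans (sum-≈ b b′ g≈ h≈)
    (G.trans (G.reflexive (≡.cong (λ k → (a +ᴬ a′) +ᴬ k ·ᴬ ρ) eq)) (GM.+-×-carry _ ρ β n))

  Φ-sum : ∀ w (c c′ : ∃ H) {b b′ g h} → b ℕ.< β → b′ ℕ.< β →
          g ≈ᴬ proj₁ c +ᴬ b ·ᴬ ρ → h ≈ᴬ proj₁ c′ +ᴬ b′ ·ᴬ ρ →
          Cᴳ.coord (Φ w) g + Cᴳ.coord (Φ w) h
          ≈ β · (Cᴴ.coord w c + Cᴴ.coord w c′) + (b ℕ.+ b′) · Cᴴ.coord w βρ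
  Φ-sum w c c′ {b} {b′} b<β b′<β g≈ h≈ =
    trans (+-cong (Φ-≈ w c b<β g≈) (Φ-≈ w c′ b′<β h≈))
    (trans (+-×-interchange _ _ (Cᴴ.coord w βρ) b b′) (+-congʳ (sym (×-distrib-+ _ _ β))))

  -- A carry turns β copies of `ρ` into the element `βρ` of `H`. Their contribution, β times the
  -- coordinate of `w` at `βρ`, is moved under the factor β accordingly.
  Φ-sum-carry : ∀ w (c c′ : ∃ H) {b b′ n g h} → b ℕ.< β → b′ ℕ.< β → b ℕ.+ b′ ≡ β ℕ.+ n →
          g ≈ᴬ proj₁ c +ᴬ b ·ᴬ ρ → h ≈ᴬ proj₁ c′ +ᴬ b′ ·ᴬ ρ →
          Cᴳ.coord (Φ w) g + Cᴳ.coord (Φ w) h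
          ≈ β · (Cᴴ.coord w c + Cᴴ.coord w c′ + Cᴴ.coord w βρ) + n · Cᴴ.coord w βρ
  Φ-sum-carry w c c′ {b} {b′} {n} b<β b′<β eq g≈ h≈ =
    trans (Φ-sum w c c′ b<β b′<β g≈ h≈)
    (trans (+-congˡ (reflexive (≡.cong (_· Cᴴ.coord w βρ) eq)))
    (trans (+-×-carry _ (Cᴴ.coord w βρ) β n) (+-congʳ (sym (×-distrib-+ _ _ β)))))

  -- After a possible carry both sides have the same digit term, so what remains is β times an
  -- inequality for `w`: one use of subadditivity without a carry, two with it.
  Φ-Cone : ∀ {w} → w ∈ Cᴴ.Cone → Φ w ∈ Cᴳ.Cone
  Φ-Cone {w} w∈C = record
    { nonNegative = Φ-nonNeg w∈C
    ; subadditive = λ i j _ _ _ → subadditive i j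
    }
    where
    subadditiveᴴ = subadditive′ 𝔽 Hᴳ w∈C
    subadditive : ∀ i j → Cᴳ.coord (Φ w) (i +ᴬ j) ≤ Cᴳ.coord (Φ w) i + Cᴳ.coord (Φ w) j
    subadditive i j = [ no-carry , with-carry ]′ (ℕ.<-≤-connex (digit i ℕ.+ digit j) β)
      where
      no-carry : digit i ℕ.+ digit j ℕ.< β →
                 Cᴳ.coord (Φ w) (i +ᴬ j) ≤ Cᴳ.coord (Φ w) i + Cᴳ.coord (Φ w) j
      no-carry b+b′<β =
        ≤-respˡ (sym (Φ-≈ w (remainder i +ᴴ remainder j) b+b′<β
          (sum-≈ (digit i) (digit j) (decompose i) (decompose j))))
        (≤-respʳ (sym (Φ-sum w (remainder i) (remainder j) (digit<β i) (digit<β j)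
          (decompose i) (decompose j)))
        (+-monoˡ-≤ _ (·-mono-≤ β (subadditiveᴴ (remainder i) (remainder j)))))
      with-carry : β ℕ.≤ digit i ℕ.+ digit j →
                   Cᴳ.coord (Φ w) (i +ᴬ j) ≤ Cᴳ.coord (Φ w) i + Cᴳ.coord (Φ w) j
      with-carry β≤b+b′ =
        ≤-respˡ (sym (Φ-≈ w ((remainder i +ᴴ remainder j) +ᴴ βρ) n<β
          (sum-carry-≈ (digit i) (digit j) eq (decompose i) (decompose j))))
        (≤-respʳ (sym (Φ-sum-carry w (remainder i) (remainder j) (digit<β i) (digit<β j) eq
          (decompose i) (decompose j)))
        (+-monoˡ-≤ _ (·-mono-≤ β (≤-trans
          (subadditiveᴴ (remainder i +ᴴ remainder j) βρ)
          (+-monoˡ-≤ _ (subadditiveᴴ (remainder i) (remainder j)))))))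
        where
        -- Two digits sum to less than 2β, so one carry always leaves a digit.
        n = digit i ℕ.+ digit j ℕ.∸ β
        eq : digit i ℕ.+ digit j ≡ β ℕ.+ n
        eq = ≡.sym (ℕ.m+[n∸m]≡n β≤b+b′)
        n<β : n ℕ.< β
        n<β = ℕ.+-cancelˡ-< β n β
          (≡.subst (ℕ._< β ℕ.+ β) eq (ℕ.+-mono-< (digit<β i) (digit<β j)))

  -- Coordinates of differences, without and with a borrow.

  +-difference : ∀ x y → x +ᴬ (y -ᴬ x) ≈ᴬ y
  +-difference x y = G.trans (G.comm x (y -ᴬ x)) (GP.//-rightDividesˡ x y)

  difference-≈ : ∀ {g g′ h} → g +ᴬ h ≈ᴬ g′ → g′ -ᴬ g ≈ᴬ h
  difference-≈ {g} {h = h} eq = G.trans (G.∙-congʳ (G.sym eq)) (GP.xyx⁻¹≈y g h)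

  -- For `b ≤ b′` the difference has `H`-part `c′ - c` and digit `b′ - b`; adding it to `g` causes
  -- no carry.
  Φ-difference : ∀ w (c c′ : ∃ H) {b b′ g g′} → b ℕ.< β → b′ ℕ.< β → b ℕ.≤ b′ →
    g ≈ᴬ proj₁ c +ᴬ b ·ᴬ ρ → g′ ≈ᴬ proj₁ c′ +ᴬ b′ ·ᴬ ρ →
    Cᴳ.coord (Φ w) g + Cᴳ.coord (Φ w) (g′ -ᴬ g)
    ≈ β · (Cᴴ.coord w c + Cᴴ.coord w (c′ -ᴴ c)) + b′ · Cᴴ.coord w βρ
  Φ-difference w c c′ {b} {b′} {g} {g′} b<β b′<β b≤b′ g≈ g′≈ =
    trans (Φ-sum w c (c′ -ᴴ c) b<β (ℕ.≤-<-trans (ℕ.m∸n≤m b′ b) b′<β) g≈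
            (difference-≈ g+h≈g′))
          (+-congˡ (reflexive (≡.cong (_· Cᴴ.coord w βρ) (ℕ.m+[n∸m]≡n b≤b′))))
    where
    open SetoidReasoning G.setoid
    a₁ = proj₁ c
    a₂ = proj₁ c′
    g+h≈g′ : g +ᴬ ((a₂ -ᴬ a₁) +ᴬ (b′ ℕ.∸ b) ·ᴬ ρ) ≈ᴬ g′
    g+h≈g′ = begin
      g +ᴬ ((a₂ -ᴬ a₁) +ᴬ (b′ ℕ.∸ b) ·ᴬ ρ)           ≈⟨ sum-≈ b (b′ ℕ.∸ b) g≈ G.refl ⟩
      (a₁ +ᴬ (a₂ -ᴬ a₁)) +ᴬ (b ℕ.+ (b′ ℕ.∸ b)) ·ᴬ ρ  ≈⟨ G.∙-congʳ (+-difference a₁ a₂) ⟩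
      a₂ +ᴬ (b ℕ.+ (b′ ℕ.∸ b)) ·ᴬ ρ
        ≡⟨ ≡.cong (λ k → a₂ +ᴬ k ·ᴬ ρ) (ℕ.m+[n∸m]≡n b≤b′) ⟩
      a₂ +ᴬ b′ ·ᴬ ρ                                  ≈⟨ g′≈ ⟨
      g′                                             ∎

  -- For `b′ < b` one `βρ` is borrowed: the difference has `H`-part `c′ - c - βρ` and digit
  -- `β + b′ - b`, and adding it to `g` carries the `βρ` back.
  Φ-difference-carry : ∀ w (c c′ : ∃ H) {b b′ g g′} → b ℕ.< β → b′ ℕ.< b →
    g ≈ᴬ proj₁ c +ᴬ b ·ᴬ ρ → g′ ≈ᴬ proj₁ c′ +ᴬ b′ ·ᴬ ρ →
    Cᴳ.coord (Φ w) g + Cᴳ.coord (Φ w) (g′ -ᴬ g)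
    ≈ β · (Cᴴ.coord w c + Cᴴ.coord w ((c′ -ᴴ c) -ᴴ βρ) + Cᴴ.coord w βρ) + b′ · Cᴴ.coord w βρ
  Φ-difference-carry w c c′ {b} {b′} {g} {g′} b<β b′<b g≈ g′≈ =
    Φ-sum-carry w c ((c′ -ᴴ c) -ᴴ βρ) b<β n<β b+n≡β+b′ g≈ (difference-≈ g+h≈g′)
    where
    n = β ℕ.+ b′ ℕ.∸ b
    b+n≡β+b′ : b ℕ.+ n ≡ β ℕ.+ b′
    b+n≡β+b′ = ℕ.m+[n∸m]≡n (ℕ.≤-trans (ℕ.<⇒≤ b<β) (ℕ.m≤m+n β b′))
    n<β : n ℕ.< β
    n<β = ℕ.+-cancelˡ-< b n β (≡.subst₂ ℕ._<_ (≡.sym b+n≡β+b′) (ℕ.+-comm β b)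
            (ℕ.+-monoʳ-< β b′<b))
    open SetoidReasoning G.setoid
    a₁ = proj₁ c
    a₂ = proj₁ c′
    d = (a₂ -ᴬ a₁) -ᴬ β ·ᴬ ρ
    g+h≈g′ : g +ᴬ (d +ᴬ n ·ᴬ ρ) ≈ᴬ g′
    g+h≈g′ = begin
      g +ᴬ (d +ᴬ n ·ᴬ ρ)                    ≈⟨ sum-carry-≈ b n b+n≡β+b′ g≈ G.refl ⟩
      ((a₁ +ᴬ d) +ᴬ β ·ᴬ ρ) +ᴬ b′ ·ᴬ ρ      ≈⟨ G.∙-congʳ (G.assoc a₁ d (β ·ᴬ ρ)) ⟩
      (a₁ +ᴬ (d +ᴬ β ·ᴬ ρ)) +ᴬ b′ ·ᴬ ρ
        ≈⟨ G.∙-congʳ (G.∙-congˡ (GP.//-rightDividesˡ (β ·ᴬ ρ) (a₂ -ᴬ a₁))) ⟩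
      (a₁ +ᴬ (a₂ -ᴬ a₁)) +ᴬ b′ ·ᴬ ρ         ≈⟨ G.∙-congʳ (+-difference a₁ a₂) ⟩
      a₂ +ᴬ b′ ·ᴬ ρ                         ≈⟨ g′≈ ⟨
      g′                                    ∎

  -- Restriction to `H` and the equations of the image.

  restrict : Cᴳ.Point → Cᴴ.Point
  restrict x = record
    { coord      = λ c → Cᴳ.coord x (proj₁ c)
    ; coord-cong = Cᴳ.coord-cong x
    ; coord-0    = Cᴳ.coord-0 x
    }

  restrict-Cone : ∀ {x} → x ∈ Cᴳ.Cone → restrict x ∈ Cᴴ.Cone
  restrict-Cone x∈C = record
    { nonNegative = λ c → Cᴳ.Cone.nonNegative x∈C (proj₁ c)
    ; subadditive = λ c c′ → Cᴳ.Cone.subadditive x∈C (proj₁ c) (proj₁ c′)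
    }

  -- The functional cutting out `F` is pulled back along `restrict`, which is linear and maps cone
  -- to cone.
  restrict-isFace : {F : Pred Cᴴ.Point q} → Cᴴ.IsFace F →
                    Cᴳ.IsFace (λ x → x ∈ Cᴳ.Cone × restrict x ∈ F)
  restrict-isFace (φ , φ-lin , φ≥0 , F⊆ , ⊆F) =
    φ ∘ restrict ,
    record { cong   = λ x≈y → cong (x≈y ∘ proj₁)
           ; +-homo = λ x y → trans (cong (λ _ → refl)) (+-homo (restrict x) (restrict y))
           ; *-homo = λ s x → trans (cong (λ _ → refl)) (*-homo s (restrict x)) } ,
    φ≥0 ∘ restrict-Cone ,
    (λ (x∈C , x∈F) → x∈C , proj₂ (F⊆ x∈F)) ,
    (λ (x∈C , φx≈0) → x∈C , ⊆F (restrict-Cone x∈C , φx≈0))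
    where open Cᴴ.IsLinear φ-lin

  open Inverse ∣G∣≡m using ()
    renaming (to to index; from to element; strictlyInverseʳ to element-index)

  SplitsAt : ∣A∣ → Pred Cᴳ.Point _
  SplitsAt g x = Cᴳ.coord x g ≈ Cᴳ.coord x (proj₁ (remainder g)) + digit g · Cᴳ.coord x ρ

  -- Indexing the splitting equations by the enumeration of `G` makes this a finite intersection.
  -- The repeated cone memberships match the shapes of `face-⋂` and `equality-isFace`.
  Equations : Pred Cᴳ.Point _
  Equations x = (x ∈ Cᴳ.Cone × (∀ k → x ∈ Cᴳ.Cone × SplitsAt (element k) x))
              × (x ∈ Cᴳ.Cone × Cᴳ.coord x (β ·ᴬ ρ) ≈ β · Cᴳ.coord x ρ)

  Equations-isFace : Cᴳ.IsFace Equations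
  Equations-isFace = Fᴳ.face-∩
    (Fᴳ.face-⋂ λ k → Fᴳ.equality-isFace (Fᴳ.coord-linear (element k))
      (Fᴳ.+-linear (Fᴳ.coord-linear _) (Fᴳ.·-linear (digit (element k)) (Fᴳ.coord-linear ρ)))
      (λ {x} x∈C → split-≤ {x} x∈C (element k)))
    (Fᴳ.equality-isFace (Fᴳ.coord-linear _) (Fᴳ.·-linear β (Fᴳ.coord-linear ρ))
      (λ {x} x∈C → Fᴳ.coord-·-≤ x∈C β ρ))
    where
    split-≤ : ∀ {x} → x ∈ Cᴳ.Cone → ∀ g →
      Cᴳ.coord x g ≤ Cᴳ.coord x (proj₁ (remainder g)) + digit g · Cᴳ.coord x ρ
    split-≤ {x} x∈C g = ≤-respˡ (Cᴳ.coord-cong x (G.sym (decompose g)))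
      (≤-trans (subadditive′ 𝔽 G x∈C _ _) (+-monoʳ-≤ _ (Fᴳ.coord-·-≤ x∈C (digit g) ρ)))

  Image≐ : {F : Pred Cᴴ.Point q} → Cᴴ.IsFace F →
           Equations ∩ (λ x → x ∈ Cᴳ.Cone × restrict x ∈ F) ≐ Image F
  Image≐ {F = F} F-face = to , from
    where
    to : Equations ∩ (λ x → x ∈ Cᴳ.Cone × restrict x ∈ F) ⊆ Image F
    to {x} (((_ , splits) , _ , βρ-eq) , x∈C , x∈F) = w , w∈F , Φw≈x
      where
      r = proj₁ (·-divisible β)
      w : Cᴴ.Point
      w = r Cᴴ.*ᴾ restrict x
      βw≈x : ∀ c → β · Cᴴ.coord w c ≈ Cᴳ.coord x (proj₁ c)
      βw≈x c = proj₂ (·-divisible β) (Cᴳ.coord x (proj₁ c))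
      w∈F : w ∈ F
      w∈F = Fᴴ.face-·⁻ β F-face βw≈x x∈F
      -- The last equation enters here: β times either side is the coordinate of `x` at `βρ`.
      w-βρ : Cᴴ.coord w βρ ≈ Cᴳ.coord x ρ
      w-βρ = ·-cancel-≈ β (trans (βw≈x βρ) βρ-eq)
      Φw≈x : Φ w Cᴳ.≈ᴾ x
      Φw≈x g = begin
        Cᴳ.coord (Φ w) g   ≈⟨ Cᴳ.coord-cong (Φ w) (element-index g) ⟨
        Cᴳ.coord (Φ w) g′  ≈⟨ +-cong (βw≈x (remainder g′)) (×-congʳ (digit g′) w-βρ) ⟩
        Cᴳ.coord x (proj₁ (remainder g′)) + digit g′ · Cᴳ.coord x ρ
                           ≈⟨ proj₂ (splits (index g)) ⟨
        Cᴳ.coord x g′      ≈⟨ Cᴳ.coord-cong x (element-index g) ⟩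
        Cᴳ.coord x g       ∎
        where
        open SetoidReasoning setoid
        -- The splitting equations are known at enumerated elements only, so `g` is replaced by its
        -- enumerated copy.
        g′ = element (index g)
    from : Image F ⊆ Equations ∩ (λ x → x ∈ Cᴳ.Cone × restrict x ∈ F)
    from {x} (w , w∈F , Φw≈x) =
      ((x∈C , λ k → x∈C , splits (element k)) , x∈C , βρ-eq) , x∈C ,
      Fᴴ.face-·⁺ β F-face βw≈x (restrict-Cone x∈C) w∈F
      where
      x∈C : x ∈ Cᴳ.Cone
      x∈C = Fᴳ.Cone-resp-≈ {Φ w} {x} Φw≈x (Φ-Cone (Fᴴ.face-⊆ F-face w∈F))
      βw≈x : ∀ c → β · Cᴴ.coord w c ≈ Cᴳ.coord x (proj₁ c)
      βw≈x c = trans (sym (Φ-H w c)) (Φw≈x _)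
      w-βρ : Cᴴ.coord w βρ ≈ Cᴳ.coord x ρ
      w-βρ = trans (sym (Φ-ρ w)) (Φw≈x ρ)
      splits : ∀ g → SplitsAt g x
      splits g = trans (sym (Φw≈x g)) (+-cong (βw≈x _) (×-congʳ (digit g) w-βρ))
      βρ-eq : Cᴳ.coord x (β ·ᴬ ρ) ≈ β · Cᴳ.coord x ρ
      βρ-eq = trans (sym (βw≈x βρ)) (×-congʳ β w-βρ)

  Image-isFace : {F : Pred Cᴴ.Point q} → Cᴴ.IsFace F → Cᴳ.IsFace (Image F)
  Image-isFace F-face = Fᴳ.face-resp-≐ (Image≐ F-face)
    (Fᴳ.face-∩ Equations-isFace (restrict-isFace F-face))

  -- The Kunz poset of the image and the augmented extension.

  module KunzPoset {F : Pred Cᴴ.Point q} (F-face : Cᴴ.IsFace F) where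
    private
      P = Cᴴ.kunz F
      Q = Cᴳ.kunz (Image F)
      module P = QuotientRelation P
      module Q = QuotientRelation Q
      F⊆C = Fᴴ.face-⊆ F-face

    open IsPosetOnQuotient
      (kunz-isPoset 𝔽 G (Inverse⇒Injection ∣G∣≡m) (Fᴳ.face-⊆ (Image-isFace F-face)))
    open IsPartialOrder isPartialOrder using () renaming
      (reflexive to ⪯-reflexive; trans to ⪯-trans; module Eq to ~)
    module Q≤G = IsSubgroup isSubgroup

    -- Lets the order be tested on chosen representatives modulo the Kunz subgroup, since congruent
    -- elements are below each other.
    ⪯-resp : ∀ {g g′ h h′} → CongruentMod G Q.K g h → CongruentMod G Q.K g′ h′ →
             h Q.⪯ h′ → g Q.⪯ g′
    ⪯-resp {g} {g′} {h} {h′} g~h g′~h′ h⪯h′ =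
      ⪯-trans {g} {h} {g′} (⪯-reflexive {g} {h} g~h)
      (⪯-trans {h} {h′} {g′} h⪯h′ (⪯-reflexive {h′} {g′} (~.sym {g′} {h′} g′~h′)))

    -- Points of the image are only pointwise equal to some `Φ w`; this reduces membership to the
    -- points `Φ w` themselves, as `⪯Q` does for the order.
    ∈Q : ∀ {g} → (∀ w → w ∈ F → Cᴳ.coord (Φ w) g ≈ 0#) → g ∈ Q.K
    ∈Q Φw≈0 x (w , w∈F , Φw≈x) = trans (sym (Φw≈x _)) (Φw≈0 w w∈F)

    Φ∈Image : ∀ {w} → w ∈ F → Φ w ∈ Image F
    Φ∈Image w∈F = _ , w∈F , λ _ → refl

    P⊆Q : ∀ {c} → c ∈ P.K → proj₁ c ∈ Q.K
    P⊆Q {c} c∈P = ∈Q λ w w∈F →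
      trans (Φ-H w c) (trans (×-congʳ β (c∈P w w∈F)) (·-zeroʳ β))

    -- The `H`-part and the digit part of a coordinate of `Φ w` are both non-negative, so a zero sum
    -- makes each vanish. Here the `H`-part is used.
    remainder∈P : ∀ {g} → g ∈ Q.K → remainder g ∈ P.K
    remainder∈P {g} g∈Q w w∈F = ·-≈0 β (+-conicalˡ
      (·-nonNeg β (Cᴴ.Cone.nonNegative (F⊆C w∈F) _))
      (·-nonNeg (digit g) (Cᴴ.Cone.nonNegative (F⊆C w∈F) βρ))
      (g∈Q (Φ w) (Φ∈Image w∈F)))

    -- The digit part vanishes for every `w` in `F`; a positive digit could be cancelled, putting
    -- `βρ` into `P.K`.
    digit≡0 : βρ ∉ P.K → ∀ {g} → g ∈ Q.K → digit g ≡ 0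
    digit≡0 βρ∉P {g} g∈Q = ≡0 (digit g) λ w w∈F → +-conicalʳ
      (·-nonNeg β (Cᴴ.Cone.nonNegative (F⊆C w∈F) _))
      (·-nonNeg (digit g) (Cᴴ.Cone.nonNegative (F⊆C w∈F) βρ))
      (g∈Q (Φ w) (Φ∈Image w∈F))
      where
      ≡0 : ∀ n → (∀ w → w ∈ F → n · Cᴴ.coord w βρ ≈ 0#) → n ≡ 0
      ≡0 zero      _    = ≡.refl
      ≡0 n@(suc _) nv≈0 = ⊥-elim (βρ∉P λ w w∈F → ·-≈0 n (nv≈0 w w∈F))

    -- For w in the cone of H the chain w_c′ ≤ w_c + w_{c′-c} ≤ w_c + w_{c′-c-βρ} + w_βρ
    -- collapses as soon as its ends agree.
    carry-tight : ∀ w → w ∈ Cᴴ.Cone → (c c′ : ∃ H) →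
      Cᴴ.coord w c + Cᴴ.coord w ((c′ -ᴴ c) -ᴴ βρ) + Cᴴ.coord w βρ ≈ Cᴴ.coord w c′ →
      (Cᴴ.coord w c + Cᴴ.coord w (c′ -ᴴ c) ≈ Cᴴ.coord w c′)
      × (Cᴴ.coord w βρ + Cᴴ.coord w ((c′ -ᴴ c) -ᴴ βρ) ≈ Cᴴ.coord w (c′ -ᴴ c))
    carry-tight w w∈C c c′ eq = c⪯c′ , βρ⪯c′-c
      where
      d = (c′ -ᴴ c) -ᴴ βρ
      upper : Cᴴ.coord w (c′ -ᴴ c) ≤ Cᴴ.coord w βρ + Cᴴ.coord w d
      upper = ≤-respˡ (Cᴴ.coord-cong w (+-difference (β ·ᴬ ρ) (proj₁ (c′ -ᴴ c))))
                      (subadditive′ 𝔽 Hᴳ w∈C βρ d)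
      lower : Cᴴ.coord w c′ ≤ Cᴴ.coord w c + Cᴴ.coord w (c′ -ᴴ c)
      lower = ≤-respˡ (Cᴴ.coord-cong w (+-difference (proj₁ c) (proj₁ c′)))
                      (subadditive′ 𝔽 Hᴳ w∈C c (c′ -ᴴ c))
      eq′ : Cᴴ.coord w c + (Cᴴ.coord w βρ + Cᴴ.coord w d) ≈ Cᴴ.coord w c′
      eq′ = trans (+-congˡ (+-comm _ _)) (trans (sym (+-assoc _ _ _)) eq)
      c⪯c′ : Cᴴ.coord w c + Cᴴ.coord w (c′ -ᴴ c) ≈ Cᴴ.coord w c′
      c⪯c′ = ≤-antisym (≤-respʳ eq′ (+-monoʳ-≤ _ upper)) lower
      βρ⪯c′-c : Cᴴ.coord w βρ + Cᴴ.coord w d ≈ Cᴴ.coord w (c′ -ᴴ c)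
      βρ⪯c′-c = K.∙-cancelˡ (Cᴴ.coord w c) _ _ (trans eq′ (sym c⪯c′))

    cancel-digit : ∀ {u v z} b → β · u + b · z ≈ β · v + b · z → u ≈ v
    cancel-digit {z = z} b eq = ·-cancel-≈ β (K.∙-cancelʳ (b · z) _ _ eq)

    -- Cancelling the common digit term `b′` and the factor β leaves a condition on `w`. With a
    -- borrow it says that the chain in `carry-tight` is tight, which yields both order relations.
    ⪯-digits⁻ : ∀ (c c′ : ∃ H) {b b′ g g′} → b ℕ.< β → b′ ℕ.< β →
      g ≈ᴬ proj₁ c +ᴬ b ·ᴬ ρ → g′ ≈ᴬ proj₁ c′ +ᴬ b′ ·ᴬ ρ → g Q.⪯ g′ →
      (c P.⪯ c′) × ((b ℕ.≤ b′) ⊎ (βρ P.⪯ (c′ -ᴴ c)))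
    ⪯-digits⁻ c c′ {b} {b′} {g} {g′} b<β b′<β g≈ g′≈ g⪯g′ =
      [ no-carry , with-carry ]′ (ℕ.≤-<-connex b b′)
      where
      no-carry : b ℕ.≤ b′ → (c P.⪯ c′) × ((b ℕ.≤ b′) ⊎ (βρ P.⪯ (c′ -ᴴ c)))
      no-carry b≤b′ = (λ w w∈F → cancel-digit b′
        (trans (sym (Φ-difference w c c′ b<β b′<β b≤b′ g≈ g′≈))
        (trans (g⪯g′ (Φ w) (Φ∈Image w∈F)) (Φ-≈ w c′ b′<β g′≈)))) , inj₁ b≤b′
      with-carry : b′ ℕ.< b → (c P.⪯ c′) × ((b ℕ.≤ b′) ⊎ (βρ P.⪯ (c′ -ᴴ c)))
      with-carry b′<b =
        (λ w w∈F → proj₁ (collapsed w w∈F)) , inj₂ (λ w w∈F → proj₂ (collapsed w w∈F))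
        where
        collapsed = λ w (w∈F : w ∈ F) → carry-tight w (F⊆C w∈F) c c′ (cancel-digit b′
          (trans (sym (Φ-difference-carry w c c′ b<β b′<b g≈ g′≈))
          (trans (g⪯g′ (Φ w) (Φ∈Image w∈F)) (Φ-≈ w c′ b′<β g′≈))))

    ⪯Q : ∀ {g g′} → (∀ w → w ∈ F →
           Cᴳ.coord (Φ w) g + Cᴳ.coord (Φ w) (g′ -ᴬ g) ≈ Cᴳ.coord (Φ w) g′) → g Q.⪯ g′
    ⪯Q {g} {g′} Φ-eq x (w , w∈F , Φw≈x) =
      trans (sym (+-cong (Φw≈x g) (Φw≈x (g′ -ᴬ g)))) (trans (Φ-eq w w∈F) (Φw≈x g′))

    ⪯-digits⁺ : ∀ (c c′ : ∃ H) {b b′ g g′} → b ℕ.< β → b′ ℕ.< β →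
      g ≈ᴬ proj₁ c +ᴬ b ·ᴬ ρ → g′ ≈ᴬ proj₁ c′ +ᴬ b′ ·ᴬ ρ →
      c P.⪯ c′ → (b ℕ.≤ b′) ⊎ (βρ P.⪯ (c′ -ᴴ c)) → g Q.⪯ g′
    ⪯-digits⁺ c c′ {b} {b′} {g} {g′} b<β b′<β g≈ g′≈ c⪯c′ =
      -- The second alternative does not exclude `b ≤ b′`, so the digits are compared again before
      -- the borrow is used.
      [ no-carry , (λ βρ⪯ → [ no-carry , with-carry βρ⪯ ]′ (ℕ.≤-<-connex b b′)) ]′
      where
      no-carry : b ℕ.≤ b′ → g Q.⪯ g′
      no-carry b≤b′ = ⪯Q λ w w∈F →
        trans (Φ-difference w c c′ b<β b′<β b≤b′ g≈ g′≈)
        (trans (+-congʳ (×-congʳ β (c⪯c′ w w∈F))) (sym (Φ-≈ w c′ b′<β g′≈)))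
      with-carry : βρ P.⪯ (c′ -ᴴ c) → b′ ℕ.< b → g Q.⪯ g′
      with-carry βρ⪯ b′<b = ⪯Q λ w w∈F →
        trans (Φ-difference-carry w c c′ b<β b′<b g≈ g′≈)
        (trans (+-congʳ (×-congʳ β (trans (+-assoc _ _ _)
          (trans (+-congˡ (trans (+-comm _ _) (βρ⪯ w w∈F))) (c⪯c′ w w∈F)))))
        (sym (Φ-≈ w c′ b′<β g′≈)))

    -- By `digit≡0` the elements of the Kunz subgroup are their own remainders, so it is `H′`. The
    -- order is then read off from remainders and digits.
    kunz≋extend : βρ ∉ P.K → Q ≋ extend P
    kunz≋extend βρ∉P = (to-K , from-K) , λ g g′ → mk⇔ (to-⪯ g g′) (from-⪯ g g′)
      where
      module E = QuotientRelation (extend P)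
      to-K : Q.K ⊆ E.K
      to-K {g} g∈Q = remainder g , remainder∈P g∈Q ,
        G.trans (decompose g) (G.trans
          (G.∙-congˡ (G.reflexive (≡.cong (_·ᴬ ρ) (digit≡0 βρ∉P {g} g∈Q))))
          (G.identityʳ _))
      from-K : E.K ⊆ Q.K
      from-K (c , c∈P , g≈c) = Q≤G.resp (G.sym g≈c) (P⊆Q {c} c∈P)
      ≈⇒E : ∀ {g h} → g ≈ᴬ h → CongruentMod G E.K g h
      ≈⇒E g≈h = 0ᴴ , (λ w _ → Cᴴ.coord-0 w) , GP.x≈y⇒x∙y⁻¹≈ε g≈h
      to-⪯ : ∀ g g′ → g Q.⪯ g′ → g E.⪯ g′
      to-⪯ g g′ g⪯g′ = remainder g , remainder g′ , digit g , digit g′ ,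
        digit<β g , digit<β g′ , ≈⇒E (decompose g) , ≈⇒E (decompose g′) ,
        ⪯-digits⁻ (remainder g) (remainder g′) (digit<β g) (digit<β g′)
          (decompose g) (decompose g′) g⪯g′
      from-⪯ : ∀ g g′ → g E.⪯ g′ → g Q.⪯ g′
      from-⪯ g g′ (c , c′ , b , b′ , b<β , b′<β , g~ , g′~ , c⪯c′ , alt) =
        ⪯-resp {g} {g′} (from-K g~) (from-K g′~)
          (⪯-digits⁺ c c′ b<β b′<β G.refl G.refl c⪯c′ alt)

    -- Now the coordinate at `ρ` vanishes on the image, so `ρ` joins the Kunz subgroup and every `g`
    -- is congruent to its remainder. The order is compared on elements of `H`, taken with digit 0.
    kunz≋collapse : βρ ∈ P.K → Q ≋ collapse P
    kunz≋collapse βρ∈P = (to-K , from-K) , λ g g′ → mk⇔ (to-⪯ g g′) (from-⪯ g g′)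
      where
      module E = QuotientRelation (collapse P)
      to-K : Q.K ⊆ E.K
      to-K {g} g∈Q = remainder g , remainder∈P g∈Q , digit g , decompose g
      ρ∈Q : ρ ∈ Q.K
      ρ∈Q = ∈Q λ w w∈F → trans (Φ-ρ w) (βρ∈P w w∈F)
      multiple∈Q : ∀ n → n ·ᴬ ρ ∈ Q.K
      multiple∈Q zero    = Q≤G.0-closed
      multiple∈Q (suc n) = Q≤G.+-closed ρ∈Q (multiple∈Q n)
      from-K : E.K ⊆ Q.K
      from-K (c , c∈P , n , g≈) =
        Q≤G.resp (G.sym g≈) (Q≤G.+-closed (P⊆Q {c} c∈P) (multiple∈Q n))
      ~remainder : ∀ g → CongruentMod G E.K g (proj₁ (remainder g))
      ~remainder g = 0ᴴ , (λ w _ → Cᴴ.coord-0 w) , digit g ,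
        G.trans (G.trans (G.∙-congʳ (decompose g)) (GP.xyx⁻¹≈y _ _)) (G.sym (G.identityˡ _))
      0<β = ℕ.>-nonZero⁻¹ β
      H-≈ : ∀ h → h ≈ᴬ h +ᴬ 0 ·ᴬ ρ
      H-≈ h = G.sym (G.identityʳ h)
      to-⪯ : ∀ g g′ → g Q.⪯ g′ → g E.⪯ g′
      to-⪯ g g′ g⪯g′ = remainder g , remainder g′ , ~remainder g , ~remainder g′ ,
        proj₁ (⪯-digits⁻ (remainder g) (remainder g′) 0<β 0<β (H-≈ _) (H-≈ _)
          (⪯-resp {r} {r′} {g} {g′} (~.sym {g} {r} (from-K (~remainder g)))
            (~.sym {g′} {r′} (from-K (~remainder g′))) g⪯g′))
        where
        r  = proj₁ (remainder g)
        r′ = proj₁ (remainder g′)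
      from-⪯ : ∀ g g′ → g E.⪯ g′ → g Q.⪯ g′
      from-⪯ g g′ (c , c′ , g~ , g′~ , c⪯c′) =
        ⪯-resp {g} {g′} {proj₁ c} {proj₁ c′} (from-K g~) (from-K g′~)
          -- Both digits are 0, so the digit condition is `0 ≤ 0`.
          (⪯-digits⁺ c c′ 0<β 0<β (H-≈ _) (H-≈ _) c⪯c′ (inj₁ ℕ.z≤n))

theorem6p7 :
  ∀ {f f₁ f₂ f₃ a ℓ p q} (𝔽 : OrderedField f f₁ f₂ f₃)
    (G : AbelianGroup a ℓ) {m : ℕ} (∣G∣≡m : HasCardinality (AbelianGroup.setoid G) m)
    {H : Pred (AbelianGroup.Carrier G) p} (H≤G : IsSubgroup G H)
    {β : ℕ} (∣G/H∣≡β : HasCardinality (quotient G H≤G) β)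
    {ρ : AbelianGroup.Carrier G} (gen : Generates G H ρ) →
  let open CyclicQuotient G H≤G ∣G/H∣≡β gen
      open Embedding 𝔽
      module Cᴳ = GroupCone 𝔽 G
      module Cᴴ = GroupCone 𝔽 Hᴳ
  in
    Cᴳ.IsFace (Image Cᴴ.Cone)
    × ((F : Pred Cᴴ.Point q) → Cᴴ.IsFace F →
         Cᴳ.IsFace (Image F) × IsAugmentedExtension (Cᴴ.kunz F) (Cᴳ.kunz (Image F)))
theorem6p7 𝔽 G ∣G∣≡m H≤G ∣G/H∣≡β gen =
  M.Image-isFace (FaceProperties.Cone-isFace 𝔽 _) ,
  λ F F-face → M.Image-isFace F-face ,
    M.KunzPoset.kunz≋extend F-face , M.KunzPoset.kunz≋collapse F-face
  where module M = Monoscopic 𝔽 G ∣G∣≡m H≤G ∣G/H∣≡β gen
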